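{- Let $n$ and $k$ be positive integers and let $x$ be an integer with $$0\le x \le \binom{n}{\left\lfloor \frac{n}{2}\right\rfloor + (-1)^k\left\lfloor \frac{k}{2}\right\rfloor}.$$ Let $F=\mathcal{B}(n,k-1)\cup X$, where $X$ consists of exactly $x$ sets from the $k$th middle row $\mathcal{B}(n,k)\setminus\mathcal{B}(n,k-1)$. Then $|F|=x+\Sigma(n,k-1)$, the family $F$ contains exactly $$x\cdot\prod_{i=1}^{k-1}\left(\left\lfloor\frac{n+k}{2}\right\rfloor-i+1\right)$$ copies of $\mathcal{P}_k$, and this is the minimum number of copies of $\mathcal{P}_k$ over all families of $x+\Sigma(n,k-1)$ subsets of $[n]=\{1,\dots,n\}$.
   Context: For a set $S$, $\binom{S}{j}$ denotes the collection of all $j$-element subsets of $S$ (empty if $j<0$ or $j>|S|$), and $\binom{n}{j}=0$ if $j<0$ or $j>n$. For an integer $m\ge 0$, $\mathcal{B}(n,m)$ denotes a family of all subsets of $[n]$ of the $m$ middle sizes, i.e. either $$\mathcal{B}(n,m)=\binom{[n]}{\lfloor (n-m+1)/2\rfloor}\cup\cdots\cup\binom{[n]}{\lfloor (n+m-1)/2\rfloor}$$ or $$\mathcal{B}(n,m)=\binom{[n]}{\lceil (n-m+1)/2\rceil}\cup\cdots\cup\binom{[n]}{\lceil (n+m-1)/2\rceil}.$$ (Depending on the parity of $n$ and $m$, these are one or two different families; they have the same size. For $m=0$ the family is empty.) Where there is a choice for $\mathcal{B}(n,k-1)$ or $\mathcal{B}(n,k)$, any choice may be made; $\mathcal{B}(n,k-1)\subseteq\mathcal{B}(n,k)$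 always holds. $\Sigma(n,m)=|\mathcal{B}(n,m)|$ denotes the common size; in particular $\Sigma(n,0)=0$. $\mathcal{P}_k$ denotes the $k$-element totally ordered set (chain). Families of subsets are ordered by inclusion, and a copy of $\mathcal{P}_k$ in a family is a set of $k$ of its members that is totally ordered by inclusion. An empty product equals $1$. -}

module Defs where

open import Data.Bool using (Bool; T; not; _∧_; _∨_)
open import Data.Bool.Properties using (T?)
open import Data.Fin.Subset using (Subset; inside; outside; _⊆_; ∣_∣)
open import Data.Fin.Subset.Properties using (_⊆?_)
open import Data.Integer using (ℤ; +_; -[1+_]; -_; _+_; _-_; _*_; _≤?_; _/ℕ_; 1ℤ)
open import Data.List using (List; []; _∷_; [_]; _++_; map; filter; length)
open import Data.List.Relation.Unary.AllPairs using (allPairs?)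
open import Data.Nat using (ℕ; zero; suc)
open import Data.Nat.Combinatorics using (_C_)
open import Data.Sum using (_⊎_)
open import Data.Vec using ([]; _∷_)
open import Relation.Binary using (Decidable)
open import Relation.Nullary.Decidable using (does; _×-dec_; _⊎-dec_)

-- The value at indices j > n is already 0 for the library's _C_.
binom : ℕ → ℤ → ℕ
binom n (+ j)    = n C j
binom n -[1+ _ ] = 0

-- ∏ m f is the product of f i over 1 ≤ i ≤ m.
∏ : ℕ → (ℕ → ℤ) → ℤ
∏ zero    f = 1ℤ
∏ (suc m) f = ∏ m f * f (suc m)

data Rounding : Set where
  floor ceiling : Rounding

-- _/ℕ_ rounds towards -∞, for negative dividends too.
half : Rounding → ℤ → ℤ
half floor   z = z /ℕ 2
half ceiling z = - ((- z) /ℕ 2)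

-- A family of subsets of [n], given by its characteristic function.
Family : ℕ → Set
Family n = Subset n → Bool

infix 4 _∈ᶠ_ _⊆ᶠ_
infixr 6 _∪ᶠ_
infixl 6 _∖ᶠ_

_∈ᶠ_ : ∀ {n} → Subset n → Family n → Set
A ∈ᶠ F = T (F A)

_⊆ᶠ_ : ∀ {n} → Family n → Family n → Set
F ⊆ᶠ G = ∀ A → A ∈ᶠ F → A ∈ᶠ G

_∪ᶠ_ _∖ᶠ_ : ∀ {n} → Family n → Family n → Family n
(F ∪ᶠ G) A = F A ∨ G A
(F ∖ᶠ G) A = F A ∧ not (G A)

-- Every subset of [n], each listed exactly once.
allSubsets : ∀ n → List (Subset n)
allSubsets zero    = [ [] ]
allSubsets (suc n) = map (inside ∷_) (allSubsets n) ++ map (outside ∷_) (allSubsets n)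

members : ∀ {n} → Family n → List (Subset n)
members {n} F = filter (λ A → T? (F A)) (allSubsets n)

∣_∣ᶠ : ∀ {n} → Family n → ℕ
∣ F ∣ᶠ = length (members F)

-- The sublists of length k; when the list has no repetitions these are its
-- k-element subsets, each listed exactly once.
choose : ∀ {A : Set} → ℕ → List A → List (List A)
choose zero    xs       = [ [] ]
choose (suc k) []       = []
choose (suc k) (x ∷ xs) = map (x ∷_) (choose k xs) ++ choose (suc k) xs

Comparable : ∀ {n} → Subset n → Subset n → Set
Comparable A B = A ⊆ B ⊎ B ⊆ A

comparable? : ∀ {n} → Decidable (Comparable {n})
comparable? A B = (A ⊆? B) ⊎-dec (B ⊆? A)

-- The number of copies of the k-element chain in F.
copies : ∀ {n} → ℕ → Family n → ℕ
copies k F = length (filter (allPairs? comparable?) (choose k (members F)))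

-- 𝓑 r n m consists of the sets whose size lies between the roundings of
-- (n-m+1)/2 and (n+m-1)/2; the choice of r gives the two versions.
𝓑 : Rounding → ∀ n → ℕ → Family n
𝓑 r n m A = does ((half r (+ n - + m + 1ℤ) ≤? + ∣ A ∣) ×-dec (+ ∣ A ∣ ≤? half r (+ n + + m - 1ℤ)))

-- The size does not depend on the rounding.
Σ∣𝓑∣ : ℕ → ℕ → ℕ
Σ∣𝓑∣ n m = ∣ 𝓑 floor n m ∣ᶠ

{-# OPTIONS --safe #-}
-- Lower bound. Average over the maximal chains of the Boolean lattice, each
-- truncated to the sizes j, …, n − j with weight C(n,j) − C(n,j−1) for j ≤ n/2;
-- then every set has total weight 1 (this replaces a symmetric chain
-- decomposition). A family F meets a truncated chain in t sets, and
-- t ≤ C(t,k) + min(k−1, n+1−2j); the minima add up to Σ(n,k−1), so the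
-- k-chains of F have total weight at least |F| − Σ(n,k−1). A k-chain with sizes
-- a₁ > … > a_k has weight
-- min(C(n,a₁), C(n,a_k)) (n−a₁)! (a₁−a₂)! ⋯ a_k! / n!, which is at most the
-- reciprocal of M_k = m(m−1)⋯(m−k+2), m = ⌊(n+k)/2⌋, unless a₁ = n and a_k = 0.
-- If [n] ∈ F, delete it: by the bound for k − 1, it lies on at least M_k of the
-- k-chains of F.
--
-- Equality. A k-chain within k consecutive rows takes one set from each row, so
-- it can be counted from its member in X, by descending or ascending one row at
-- a time.
module Submission where

open import Defs

-- The weights telescope: a set of size b lies in the truncations with j ≤ min(b, n - b), whose
-- weights add up to C(n,b), and a random maximal chain passes through the set with probability
-- 1/C(n,b). Multiplying by n! turns averages into sums over all maximal chains, so everything stays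
-- in ℕ.
--
-- Origin of M_k: let a and l be the largest and smallest size of a k-chain, with l + a ≤ n (the
-- other case is the mirror image). The factor C(n,l) cancels l! and leaves (n - l)! against the
-- factorials of k parts of n - l, namely n - a and the gaps. If all are positive, x! y! ≤ (x + y -
-- 1)! merges them into one part, smaller than n - l by k - 1. A falling factorial of k - 1 factors
-- starting at n - l remains, and n - l ≥ m because a - l ≥ k - 1. For a = n the part n - a is empty
-- and the bound can fail: for k = 2 the chain of ∅ and [n] has weight 1.
--
-- The deletion of [n] is affordable because a family with more than Σ(n,k-1) sets, once [n] is
-- removed, still exceeds Σ(n,k-2) by a whole row.

module Supersaturation where

  open import Data.Bool using (Bool; true; false; T; _∧_; _∨_; not)
  open import Data.Bool.Properties using (T?)
  open import Data.Empty using (⊥-elim)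
  open import Data.Fin.Subset using (Subset; inside; outside; ∣_∣; ⊤)
  open import Data.Fin.Subset.Properties using (_⊆?_; ∣p∣≤n; ∣⊤∣≡n)
  open import Data.List using (List; []; _∷_; [_]; _++_; map; filter; length; concatMap; downFrom)
  open import Data.List.Membership.Propositional using (_∈_; find)
  open import Data.List.Membership.Propositional.Properties using (∈-filter⁻; ∈-map⁻; ∈-concatMap⁻; ∈-downFrom⁻)
  open import Data.List.Properties using (length-map)
  open import Data.List.Relation.Unary.All as All using ([]; _∷_; all?)
  import Data.List.Relation.Unary.All.Properties as All
  open import Data.List.Relation.Unary.AllPairs using (AllPairs; []; _∷_; allPairs?)
  import Data.List.Relation.Unary.AllPairs.Properties as AllPairs
  open import Data.List.Relation.Unary.Any using (here; there)
  open import Data.List.Relation.Unary.Linked using (Linked; [-]; _∷_)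
  open import Data.Nat
  open import Data.Nat.Combinatorics hiding (_P_)
  open import Data.Nat.DivMod using (m/n*n≡m; m/n≡1+[m∸n]/n)
  open import Data.Nat.ListAction using (sum)
  open import Data.Nat.Properties
  open import Data.Nat.Tactic.RingSolver using (solve-∀)
  open import Data.Product using (_×_; _,_; ∃; proj₁; proj₂)
  open import Data.Sum using (_⊎_; inj₁; inj₂)
  open import Data.Vec using ([]; _∷_)
  open import Function using (_∘_; case_of_)
  open import Level using (0ℓ)
  open import Relation.Binary.Definitions using (tri<; tri≈; tri>)
  open import Relation.Binary.PropositionalEquality using (_≡_; _≢_; refl; sym; trans; cong; cong₂; subst; module ≡-Reasoning)
  open import Relation.Nullary using (yes; no)
  open import Relation.Nullary.Decidable using (does; dec-true)
  open import Relation.Unary using (Pred; Decidable)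

  -- Finite sums

  ∑ : ∀ {A : Set} → List A → (A → ℕ) → ℕ
  ∑ xs f = sum (map f xs)

  ∑-cong : ∀ {A : Set} (xs : List A) {f g : A → ℕ} → (∀ {x} → x ∈ xs → f x ≡ g x) → ∑ xs f ≡ ∑ xs g
  ∑-cong []       eq = refl
  ∑-cong (x ∷ xs) eq = cong₂ _+_ (eq (here refl)) (∑-cong xs (eq ∘ there))

  ∑-mono : ∀ {A : Set} (xs : List A) {f g : A → ℕ} → (∀ {x} → x ∈ xs → f x ≤ g x) → ∑ xs f ≤ ∑ xs g
  ∑-mono []       le = z≤n
  ∑-mono (x ∷ xs) le = +-mono-≤ (le (here refl)) (∑-mono xs (le ∘ there))

  ∑-++ : ∀ {A : Set} (xs ys : List A) f → ∑ (xs ++ ys) f ≡ ∑ xs f + ∑ ys f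
  ∑-++ []       ys f = refl
  ∑-++ (x ∷ xs) ys f = trans (cong (f x +_) (∑-++ xs ys f)) (sym (+-assoc (f x) _ _))

  ∑-map : ∀ {A B : Set} (h : A → B) (xs : List A) f → ∑ (map h xs) f ≡ ∑ xs (f ∘ h)
  ∑-map h []       f = refl
  ∑-map h (x ∷ xs) f = cong (f (h x) +_) (∑-map h xs f)

  ∑-concatMap : ∀ {A B : Set} (h : A → List B) xs f → ∑ (concatMap h xs) f ≡ ∑ xs (λ x → ∑ (h x) f)
  ∑-concatMap h []       f = refl
  ∑-concatMap h (x ∷ xs) f = trans (∑-++ (h x) _ f) (cong (∑ (h x) f +_) (∑-concatMap h xs f))

  ∑-+ : ∀ {A : Set} (xs : List A) f g → ∑ xs (λ x → f x + g x) ≡ ∑ xs f + ∑ xs g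
  ∑-+ []       f g = refl
  ∑-+ (x ∷ xs) f g = trans (cong (f x + g x +_) (∑-+ xs f g)) (interchange (f x) (g x) _ _)
    where
    interchange : ∀ a b c d → a + b + (c + d) ≡ a + c + (b + d)
    interchange = solve-∀

  ∑-*ˡ : ∀ {A : Set} (xs : List A) c f → ∑ xs (λ x → c * f x) ≡ c * ∑ xs f
  ∑-*ˡ []       c f = sym (*-zeroʳ c)
  ∑-*ˡ (x ∷ xs) c f = trans (cong (c * f x +_) (∑-*ˡ xs c f)) (sym (*-distribˡ-+ c (f x) _))

  ∑-*ʳ : ∀ {A : Set} (xs : List A) c f → ∑ xs (λ x → f x * c) ≡ ∑ xs f * c
  ∑-*ʳ xs c f = trans (∑-cong xs (λ {x} _ → *-comm (f x) c)) (trans (∑-*ˡ xs c f) (*-comm c _))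

  ∑-zero : ∀ {A : Set} (xs : List A) {f : A → ℕ} → (∀ {x} → x ∈ xs → f x ≡ 0) → ∑ xs f ≡ 0
  ∑-zero []       eq = refl
  ∑-zero (x ∷ xs) eq = cong₂ _+_ (eq (here refl)) (∑-zero xs (eq ∘ there))

  ∑-const : ∀ {A : Set} (xs : List A) c → ∑ xs (λ _ → c) ≡ length xs * c
  ∑-const []       c = refl
  ∑-const (x ∷ xs) c = cong (c +_) (∑-const xs c)

  ∑-swap : ∀ {A B : Set} (xs : List A) (ys : List B) (f : A → B → ℕ) →
    ∑ xs (λ x → ∑ ys (f x)) ≡ ∑ ys (λ y → ∑ xs (λ x → f x y))
  ∑-swap []       ys f = sym (∑-zero ys (λ _ → refl))
  ∑-swap (x ∷ xs) ys f =
    trans (cong (∑ ys (f x) +_) (∑-swap xs ys f)) (sym (∑-+ ys (f x) _))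

  𝟙 : Bool → ℕ
  𝟙 true  = 1
  𝟙 false = 0

  𝟙≤1 : ∀ b → 𝟙 b ≤ 1
  𝟙≤1 true  = ≤-refl
  𝟙≤1 false = z≤n

  𝟙-∧ : ∀ a b → 𝟙 (a ∧ b) ≡ 𝟙 a * 𝟙 b
  𝟙-∧ true  b = sym (+-identityʳ _)
  𝟙-∧ false b = refl

  ∑-filter : ∀ {A : Set} (p : A → Bool) xs f →
    ∑ (filter (λ x → T? (p x)) xs) f ≡ ∑ xs (λ x → 𝟙 (p x) * f x)
  ∑-filter p []       f = refl
  ∑-filter p (x ∷ xs) f with p x
  ... | true  = cong₂ _+_ (sym (+-identityʳ (f x))) (∑-filter p xs f)
  ... | false = ∑-filter p xs f

  -- Sums over subsets

  ∑ₛ : ∀ {n} → (Subset n → ℕ) → ℕ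
  ∑ₛ = ∑ (allSubsets _)

  ∑ₛ-suc : ∀ {n} (f : Subset (suc n) → ℕ) → ∑ₛ f ≡ ∑ₛ (f ∘ (inside ∷_)) + ∑ₛ (f ∘ (outside ∷_))
  ∑ₛ-suc {n} f = trans (∑-++ (map (inside ∷_) (allSubsets n)) _ f)
    (cong₂ _+_ (∑-map _ (allSubsets n) f) (∑-map _ (allSubsets n) f))

  ∑-members : ∀ {n} (F : Family n) f → ∑ (members F) f ≡ ∑ₛ (λ A → 𝟙 (F A) * f A)
  ∑-members F f = ∑-filter F (allSubsets _) f

  length≡∑ : ∀ {A : Set} (xs : List A) → length xs ≡ ∑ xs (λ _ → 1)
  length≡∑ xs = sym (trans (∑-const xs 1) (*-identityʳ _))

  ∣∣ᶠ≡∑ : ∀ {n} (F : Family n) → ∣ F ∣ᶠ ≡ ∑ₛ (𝟙 ∘ F)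
  ∣∣ᶠ≡∑ F = trans (length≡∑ (members F)) (trans (∑-members F _)
    (∑-cong (allSubsets _) (λ {A} _ → *-identityʳ (𝟙 (F A)))))

  -- ⊆ and ⊂ by recursion on the coordinates, so that sums over them split along ∑ₛ-suc.
  sub : ∀ {n} → Subset n → Subset n → Bool
  sub []            []            = true
  sub (inside ∷ B)  (inside ∷ A)  = sub B A
  sub (inside ∷ B)  (outside ∷ A) = false
  sub (outside ∷ B) (_ ∷ A)       = sub B A

  ssub : ∀ {n} → Subset n → Subset n → Bool
  ssub []            []            = false
  ssub (inside ∷ B)  (inside ∷ A)  = ssub B A
  ssub (inside ∷ B)  (outside ∷ A) = false
  ssub (outside ∷ B) (inside ∷ A)  = sub B A
  ssub (outside ∷ B) (outside ∷ A) = ssub B A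

  sub-size : ∀ {n} (B A : Subset n) → sub B A ≡ true → ∣ B ∣ ≤ ∣ A ∣
  sub-size []            []            p = z≤n
  sub-size (inside ∷ B)  (inside ∷ A)  p = s≤s (sub-size B A p)
  sub-size (outside ∷ B) (inside ∷ A)  p = m≤n⇒m≤1+n (sub-size B A p)
  sub-size (outside ∷ B) (outside ∷ A) p = sub-size B A p

  ssub-size : ∀ {n} (B A : Subset n) → ssub B A ≡ true → ∣ B ∣ < ∣ A ∣
  ssub-size []            []            ()
  ssub-size (inside ∷ B)  (inside ∷ A)  p = s≤s (ssub-size B A p)
  ssub-size (outside ∷ B) (inside ∷ A)  p = s≤s (sub-size B A p)
  ssub-size (outside ∷ B) (outside ∷ A) p = ssub-size B A p

  ssub⇒sub : ∀ {n} (B A : Subset n) → ssub B A ≡ true → sub B A ≡ true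
  ssub⇒sub []            []            ()
  ssub⇒sub (inside ∷ B)  (inside ∷ A)  p = ssub⇒sub B A p
  ssub⇒sub (outside ∷ B) (inside ∷ A)  p = p
  ssub⇒sub (outside ∷ B) (outside ∷ A) p = ssub⇒sub B A p

  sub-trans : ∀ {n} (D B A : Subset n) → sub D B ≡ true → sub B A ≡ true → sub D A ≡ true
  sub-trans []            []            []            p q = refl
  sub-trans (inside ∷ D)  (inside ∷ B)  (inside ∷ A)  p q = sub-trans D B A p q
  sub-trans (outside ∷ D) (inside ∷ B)  (inside ∷ A)  p q = sub-trans D B A p q
  sub-trans (outside ∷ D) (outside ∷ B) (_ ∷ A)       p q = sub-trans D B A p q

  ssub-trans : ∀ {n} (D B A : Subset n) → ssub D B ≡ true → ssub B A ≡ true → ssub D A ≡ true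
  ssub-trans []            []            []            () q
  ssub-trans (inside ∷ D)  (inside ∷ B)  (inside ∷ A)  p q = ssub-trans D B A p q
  ssub-trans (outside ∷ D) (inside ∷ B)  (inside ∷ A)  p q = sub-trans D B A p (ssub⇒sub B A q)
  ssub-trans (outside ∷ D) (outside ∷ B) (inside ∷ A)  p q = sub-trans D B A (ssub⇒sub D B p) q
  ssub-trans (outside ∷ D) (outside ∷ B) (outside ∷ A) p q = ssub-trans D B A p q

  -- Lower covers of a set

  covers : ∀ {n} → Subset n → List (Subset n)
  covers []            = []
  covers (inside ∷ A)  = (outside ∷ A) ∷ map (inside ∷_) (covers A)
  covers (outside ∷ A) = map (outside ∷_) (covers A)

  length-covers : ∀ {n} (A : Subset n) → length (covers A) ≡ ∣ A ∣
  length-covers []            = refl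
  length-covers (inside ∷ A)  = cong suc (trans (length-map _ (covers A)) (length-covers A))
  length-covers (outside ∷ A) = trans (length-map _ (covers A)) (length-covers A)

  ∈-covers-size : ∀ {n} (A : Subset n) {B} → B ∈ covers A → suc ∣ B ∣ ≡ ∣ A ∣
  ∈-covers-size (inside ∷ A)  (here refl) = refl
  ∈-covers-size (inside ∷ A)  (there p) with ∈-map⁻ (inside ∷_) p
  ... | _ , q , refl = cong suc (∈-covers-size A q)
  ∈-covers-size (outside ∷ A) p with ∈-map⁻ (outside ∷_) p
  ... | _ , q , refl = ∈-covers-size A q

  -- A lower cover of `A` that contains `B` arises by removing an element of `A` outside `B`.
  ∑-covers-sub : ∀ {n} (B A : Subset n) → ∑ (covers A) (𝟙 ∘ sub B) ≡ 𝟙 (ssub B A) * (∣ A ∣ ∸ ∣ B ∣)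
  ∑-covers-sub []            []            = refl
  ∑-covers-sub (inside ∷ B)  (inside ∷ A)  = trans (∑-map _ (covers A) _) (∑-covers-sub B A)
  ∑-covers-sub (inside ∷ B)  (outside ∷ A) = trans (∑-map _ (covers A) _) (∑-zero (covers A) (λ _ → refl))
  ∑-covers-sub (outside ∷ B) (outside ∷ A) = trans (∑-map _ (covers A) _) (∑-covers-sub B A)
  ∑-covers-sub (outside ∷ B) (inside ∷ A)  =
    trans (cong (𝟙 (sub B A) +_) (trans (∑-map _ (covers A) _) (∑-covers-sub B A))) (step B A)
    where
    not-ssub : ∀ {n} (B A : Subset n) → sub B A ≡ true → ssub B A ≡ false → ∣ B ∣ ≡ ∣ A ∣
    not-ssub []            []            p q = refl
    not-ssub (inside ∷ B)  (inside ∷ A)  p q = cong suc (not-ssub B A p q)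
    not-ssub (outside ∷ B) (inside ∷ A)  p q with trans (sym p) q
    ... | ()
    not-ssub (outside ∷ B) (outside ∷ A) p q = not-ssub B A p q
    step : ∀ {n} (B A : Subset n) →
      𝟙 (sub B A) + 𝟙 (ssub B A) * (∣ A ∣ ∸ ∣ B ∣) ≡ 𝟙 (sub B A) * (suc ∣ A ∣ ∸ ∣ B ∣)
    step B A with sub B A in p | ssub B A in q
    ... | true  | true  rewrite +-∸-assoc 1 (sub-size B A p) = refl
    ... | true  | false rewrite not-ssub B A p q | +-∸-assoc 1 (≤-refl {∣ A ∣}) | n∸n≡0 ∣ A ∣ = refl
    ... | false | false = refl
    ... | false | true with trans (sym p) (ssub⇒sub B A q)
    ... | ()

  -- Double counting of covering pairs: `B` is covered by the sets that add one of its `n ∸ ∣ B ∣`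
  -- missing elements.
  ∑-covers-swap : ∀ {n} (g : Subset n → ℕ) → ∑ₛ (λ A → ∑ (covers A) g) ≡ ∑ₛ (λ B → (n ∸ ∣ B ∣) * g B)
  ∑-covers-swap {zero}  g = refl
  ∑-covers-swap {suc n} g = begin
    ∑ₛ (λ A → ∑ (covers A) g)
      ≡⟨ ∑ₛ-suc (λ A → ∑ (covers A) g) ⟩
    ∑ₛ (λ A → g (outside ∷ A) + ∑ (map (inside ∷_) (covers A)) g) + ∑ₛ (λ A → ∑ (map (outside ∷_) (covers A)) g)
      ≡⟨ cong₂ _+_ (trans (∑-+ (allSubsets n) _ _) (cong (∑ₛ (g ∘ (outside ∷_)) +_) (part (inside ∷_)))) (part (outside ∷_)) ⟩
    ∑ₛ (g ∘ (outside ∷_)) + ∑ₛ (λ B → (n ∸ ∣ B ∣) * g (inside ∷ B)) + ∑ₛ (λ B → (n ∸ ∣ B ∣) * g (outside ∷ B))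
      ≡⟨ rearrange (∑ₛ (g ∘ (outside ∷_))) _ _ ⟩
    ∑ₛ (λ B → (n ∸ ∣ B ∣) * g (inside ∷ B)) + (∑ₛ (g ∘ (outside ∷_)) + ∑ₛ (λ B → (n ∸ ∣ B ∣) * g (outside ∷ B)))
      ≡⟨ cong (∑ₛ (λ B → (n ∸ ∣ B ∣) * g (inside ∷ B)) +_) (trans (sym (∑-+ (allSubsets n) _ _))
           (∑-cong (allSubsets n) (λ {B} _ → cong (_* g (outside ∷ B)) (sym (+-∸-assoc 1 (∣p∣≤n B)))))) ⟩
    ∑ₛ (λ B → (n ∸ ∣ B ∣) * g (inside ∷ B)) + ∑ₛ (λ B → (suc n ∸ ∣ B ∣) * g (outside ∷ B))
      ≡⟨ ∑ₛ-suc (λ B → (suc n ∸ ∣ B ∣) * g B) ⟨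
    ∑ₛ (λ B → (suc n ∸ ∣ B ∣) * g B) ∎
    where
    open ≡-Reasoning
    part : ∀ h → ∑ₛ (λ A → ∑ (map h (covers A)) g) ≡ ∑ₛ (λ B → (n ∸ ∣ B ∣) * g (h B))
    part h = trans (∑-cong (allSubsets n) (λ {A} _ → ∑-map h (covers A) g)) (∑-covers-swap (g ∘ h))
    rearrange : ∀ a b c → a + b + c ≡ b + (a + c)
    rearrange = solve-∀

  -- Proved together with `∑-sub-self`: if the first element belongs to `A` but not to `B`, strict
  -- inclusion becomes plain inclusion on the remaining coordinates, and there the vanishing of `g`
  -- leaves only `A` itself.
  ∑-ssub-covers : ∀ {n} (A : Subset n) (g : Subset n → ℕ) → (∀ B → suc ∣ B ∣ < ∣ A ∣ → g B ≡ 0) →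
    ∑ₛ (λ B → 𝟙 (ssub B A) * g B) ≡ ∑ (covers A) g
  ∑-sub-self : ∀ {n} (A : Subset n) (g : Subset n → ℕ) → (∀ B → ∣ B ∣ < ∣ A ∣ → g B ≡ 0) →
    ∑ₛ (λ B → 𝟙 (sub B A) * g B) ≡ g A
  ∑-ssub-covers []            g z = refl
  ∑-ssub-covers (inside ∷ A)  g z = trans (∑ₛ-suc (λ B → 𝟙 (ssub B (inside ∷ A)) * g B)) (trans
    (+-comm (∑ₛ (λ B → 𝟙 (ssub B A) * g (inside ∷ B))) _)
    (cong₂ _+_ (∑-sub-self A (g ∘ (outside ∷_)) (λ B p → z (outside ∷ B) (s≤s p)))
      (trans (∑-ssub-covers A (g ∘ (inside ∷_)) (λ B p → z (inside ∷ B) (s≤s p))) (sym (∑-map _ (covers A) g)))))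
  ∑-ssub-covers {suc n} (outside ∷ A) g z = trans (∑ₛ-suc (λ B → 𝟙 (ssub B (outside ∷ A)) * g B))
    (cong₂ _+_ (∑-zero (allSubsets n) (λ _ → refl))
      (trans (∑-ssub-covers A (g ∘ (outside ∷_)) (λ B → z (outside ∷ B))) (sym (∑-map _ (covers A) g))))
  ∑-sub-self []            g z = trans (+-identityʳ _) (+-identityʳ _)
  ∑-sub-self {suc n} (inside ∷ A)  g z = trans (∑ₛ-suc (λ B → 𝟙 (sub B (inside ∷ A)) * g B)) (trans
    (cong₂ _+_ (∑-sub-self A (g ∘ (inside ∷_)) (λ B p → z (inside ∷ B) (s≤s p)))
      (∑-zero (allSubsets n) (λ {B} _ → vanish B)))
    (+-identityʳ _))
    where
    vanish : ∀ B → 𝟙 (sub B A) * g (outside ∷ B) ≡ 0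
    vanish B with sub B A in p
    ... | true  = trans (+-identityʳ _) (z (outside ∷ B) (s≤s (sub-size B A p)))
    ... | false = refl
  ∑-sub-self {suc n} (outside ∷ A) g z = trans (∑ₛ-suc (λ B → 𝟙 (sub B (outside ∷ A)) * g B))
    (cong₂ _+_ (∑-zero (allSubsets n) (λ _ → refl)) (∑-sub-self A (g ∘ (outside ∷_)) (λ B → z (outside ∷ B))))

  -- Copies of a chain, counted from the top set down

  ∑-choose-All : ∀ {A : Set} {P : Pred A 0ℓ} (P? : Decidable P) k xs (g : List A → ℕ) →
    ∑ (choose k xs) (λ ys → 𝟙 (does (all? P? ys)) * g ys) ≡ ∑ (choose k (filter P? xs)) g
  ∑-choose-All P? zero    xs       g = cong (_+ 0) (+-identityʳ _)
  ∑-choose-All P? (suc k) []       g = refl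
  ∑-choose-All P? (suc k) (x ∷ xs) g
    rewrite ∑-++ (map (x ∷_) (choose k xs)) (choose (suc k) xs) (λ ys → 𝟙 (does (all? P? ys)) * g ys)
          | ∑-map (x ∷_) (choose k xs) (λ ys → 𝟙 (does (all? P? ys)) * g ys)
          | ∑-choose-All P? (suc k) xs g
    with does (P? x)
  ... | true  = trans (cong (_+ _) (trans (∑-choose-All P? k xs (g ∘ (x ∷_))) (sym (∑-map (x ∷_) (choose k (filter P? xs)) g))))
                      (sym (∑-++ (map (x ∷_) (choose k (filter P? xs))) (choose (suc k) (filter P? xs)) g))
  ... | false = cong (_+ ∑ (choose (suc k) (filter P? xs)) g) (∑-zero (choose k xs) (λ _ → refl))

  length-filter : ∀ {A : Set} {P : Pred A 0ℓ} (P? : Decidable P) xs → length (filter P? xs) ≡ ∑ xs (𝟙 ∘ does ∘ P?)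
  length-filter P? []       = refl
  length-filter P? (x ∷ xs) with does (P? x)
  ... | true  = cong suc (length-filter P? xs)
  ... | false = length-filter P? xs

  filter-cong : ∀ {A : Set} {P Q : Pred A 0ℓ} (P? : Decidable P) (Q? : Decidable Q) xs →
    (∀ {x} → x ∈ xs → does (P? x) ≡ does (Q? x)) → filter P? xs ≡ filter Q? xs
  filter-cong P? Q? []       eq = refl
  filter-cong P? Q? (x ∷ xs) eq with does (P? x) | does (Q? x) | eq (here refl)
  ... | true  | _ | refl = cong (x ∷_) (filter-cong P? Q? xs (eq ∘ there))
  ... | false | _ | refl = filter-cong P? Q? xs (eq ∘ there)

  filter-filter : ∀ {A : Set} (p q : A → Bool) xs →
    filter (T? ∘ p) (filter (T? ∘ q) xs) ≡ filter (λ x → T? (q x ∧ p x)) xs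
  filter-filter p q []       = refl
  filter-filter p q (x ∷ xs) with q x
  ... | false = filter-filter p q xs
  ... | true with p x
  ... | true  = cong (x ∷_) (filter-filter p q xs)
  ... | false = filter-filter p q xs

  -- `copies` is the case of `members F`. Arbitrary lists allow passing to the part comparable with
  -- a chosen set.
  chainCount : ∀ {n} → ℕ → List (Subset n) → ℕ
  chainCount k xs = length (filter (allPairs? comparable?) (choose k xs))

  chainCount-∷ : ∀ {n} k (x : Subset n) xs →
    chainCount (suc k) (x ∷ xs) ≡ chainCount k (filter (comparable? x) xs) + chainCount (suc k) xs
  chainCount-∷ k x xs = begin
    chainCount (suc k) (x ∷ xs)
      ≡⟨ length-filter (allPairs? comparable?) (choose (suc k) (x ∷ xs)) ⟩
    ∑ (map (x ∷_) (choose k xs) ++ choose (suc k) xs) chain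
      ≡⟨ ∑-++ (map (x ∷_) (choose k xs)) _ chain ⟩
    ∑ (map (x ∷_) (choose k xs)) chain + ∑ (choose (suc k) xs) chain
      ≡⟨ cong₂ _+_ (∑-map (x ∷_) (choose k xs) chain) (sym (length-filter (allPairs? comparable?) (choose (suc k) xs))) ⟩
    ∑ (choose k xs) (chain ∘ (x ∷_)) + chainCount (suc k) xs
      ≡⟨ cong (_+ chainCount (suc k) xs) (∑-cong (choose k xs) (λ {ys} _ → 𝟙-∧ (does (all? (comparable? x) ys)) _)) ⟩
    ∑ (choose k xs) (λ ys → 𝟙 (does (all? (comparable? x) ys)) * chain ys) + chainCount (suc k) xs
      ≡⟨ cong (_+ chainCount (suc k) xs) (∑-choose-All (comparable? x) k xs chain) ⟩
    ∑ (choose k (filter (comparable? x) xs)) chain + chainCount (suc k) xs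
      ≡⟨ cong (_+ chainCount (suc k) xs) (length-filter (allPairs? comparable?) (choose k (filter (comparable? x) xs))) ⟨
    chainCount k (filter (comparable? x) xs) + chainCount (suc k) xs ∎
    where
    open ≡-Reasoning
    chain : List (Subset _) → ℕ
    chain = 𝟙 ∘ does ∘ allPairs? comparable?

  does-⊆? : ∀ {n} (B A : Subset n) → does (B ⊆? A) ≡ sub B A
  does-⊆? []            []            = refl
  does-⊆? (inside ∷ B)  (inside ∷ A)  = does-⊆? B A
  does-⊆? (inside ∷ B)  (outside ∷ A) = refl
  does-⊆? (outside ∷ B) (_ ∷ A)       = does-⊆? B A

  sub≡ssub : ∀ {n} (B A : Subset n) → sub A B ≡ false → sub B A ≡ ssub B A
  sub≡ssub []            []            ()
  sub≡ssub (inside ∷ B)  (inside ∷ A)  p = sub≡ssub B A p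
  sub≡ssub (inside ∷ B)  (outside ∷ A) p = refl
  sub≡ssub (outside ∷ B) (inside ∷ A)  p = refl
  sub≡ssub (outside ∷ B) (outside ∷ A) p = sub≡ssub B A p

  ssub-irrefl : ∀ {n} (A : Subset n) → ssub A A ≡ false
  ssub-irrefl []            = refl
  ssub-irrefl (inside ∷ A)  = ssub-irrefl A
  ssub-irrefl (outside ∷ A) = ssub-irrefl A

  ¬sub⇒¬ssub : ∀ {n} (B A : Subset n) → sub B A ≡ false → ssub B A ≡ false
  ¬sub⇒¬ssub B A p with ssub B A in q
  ... | false = refl
  ... | true  = trans (sym (ssub⇒sub B A q)) p

  _⊈_ : ∀ {n} → Subset n → Subset n → Set
  B ⊈ A = sub B A ≡ false

  strictlyBelow : ∀ {n} → Subset n → List (Subset n) → List (Subset n)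
  strictlyBelow A = filter (λ B → T? (ssub B A))

  strictlyBelow-∷ : ∀ {n} (A x : Subset n) xs → ssub x A ≡ false → strictlyBelow A (x ∷ xs) ≡ strictlyBelow A xs
  strictlyBelow-∷ A x xs p rewrite p = refl

  -- No set is contained in a later one, so a later set comparable with `x` is strictly below it.
  -- Conversely `x` is not below any later set, so keeping it in the list changes none of their
  -- counts.
  chainCount-suc : ∀ {n} k (xs : List (Subset n)) → AllPairs _⊈_ xs →
    chainCount (suc k) xs ≡ ∑ xs (λ x → chainCount k (strictlyBelow x xs))
  chainCount-suc k []       []         = refl
  chainCount-suc k (x ∷ xs) (x⊈ ∷ ⊈xs) = trans (chainCount-∷ k x xs) (cong₂ _+_
    (cong (chainCount k) (trans
      (filter-cong (comparable? x) (λ B → T? (ssub B x)) xs (λ {y} y∈ → comp y (All.lookup x⊈ y∈)))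
      (sym (strictlyBelow-∷ x x xs (ssub-irrefl x)))))
    (trans (chainCount-suc k xs ⊈xs)
      (∑-cong xs (λ {y} y∈ → cong (chainCount k)
        (sym (strictlyBelow-∷ y x xs (¬sub⇒¬ssub x y (All.lookup x⊈ y∈))))))))
    where
    comp : ∀ y → x ⊈ y → does (comparable? x y) ≡ ssub y x
    comp y p rewrite does-⊆? x y | does-⊆? y x | p = sub≡ssub y x p

  -- Larger sets are listed first, so a sublist of pairwise comparable sets is a
  -- strictly descending chain.
  allSubsets-⊈ : ∀ n → AllPairs _⊈_ (allSubsets n)
  allSubsets-⊈ zero    = [] ∷ []
  allSubsets-⊈ (suc n) = AllPairs.++⁺ (AllPairs.map⁺ (allSubsets-⊈ n)) (AllPairs.map⁺ (allSubsets-⊈ n))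
    (All.map⁺ (All.universal (λ _ → All.map⁺ (All.universal (λ _ → refl) _)) _))

  below : ∀ {n} → Family n → Subset n → Family n
  below F A B = F B ∧ ssub B A

  ∈-members : ∀ {n} (F : Family n) {A} → A ∈ members F → F A ≡ true
  ∈-members {n} F {A} p with F A | proj₂ (∈-filter⁻ (λ B → T? (F B)) {xs = allSubsets n} p)
  ... | true | _ = refl

  ∧-true : ∀ a b → a ∧ b ≡ true → a ≡ true × b ≡ true
  ∧-true true true p = refl , refl

  members-cong : ∀ {n} (F G : Family n) → (∀ A → F A ≡ G A) → members F ≡ members G
  members-cong {n} F G eq = filter-cong (T? ∘ F) (T? ∘ G) (allSubsets n) (λ {A} _ → eq A)

  chainsBelow : ∀ {n} → Family n → ℕ → Subset n → ℕ
  chainsBelow F zero    A = 1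
  chainsBelow F (suc k) A = ∑ (members (below F A)) (chainsBelow F k)

  -- Splitting off top sets nests the restrictions, but `below (below F A) B` agrees with
  -- `below F B` once `B` is strictly below `A`. Hence the whole recursion refers to the one family
  -- `F`.
  copies-suc : ∀ {n} k (F : Family n) → copies (suc k) F ≡ ∑ (members F) (chainsBelow F k)
  copies-suc {n} k F = trans (decompose k F) (∑-cong (members F) (λ {A} _ → copies-below k A))
    where
    decompose : ∀ k (F : Family n) → copies (suc k) F ≡ ∑ (members F) (λ A → copies k (below F A))
    decompose k F = trans (chainCount-suc k (members F) (AllPairs.filter⁺ (λ A → T? (F A)) (allSubsets-⊈ n)))
      (∑-cong (members F) (λ {A} _ → cong (chainCount k) (filter-filter (λ B → ssub B A) F (allSubsets n))))
    absorb : ∀ A B → ssub B A ≡ true → ∀ D → below (below F A) B D ≡ below F B D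
    absorb A B p D with F D | ssub D A in q | ssub D B in r
    ... | false | _     | _     = refl
    ... | true  | true  | _     = refl
    ... | true  | false | false = refl
    ... | true  | false | true  = trans (sym q) (ssub-trans D B A r p)
    copies-below : ∀ k A → copies k (below F A) ≡ chainsBelow F k A
    copies-below zero    A = refl
    copies-below (suc k) A = trans (decompose k (below F A)) (∑-cong (members (below F A)) (λ {B} B∈ →
      trans (cong (chainCount k) (members-cong _ _ (absorb A B (proj₂ (∧-true (F B) _ (∈-members (below F A) B∈))))))
            (copies-below k B)))

  nC0≡1 : ∀ n → n C 0 ≡ 1
  nC0≡1 n = trans (nCk≡nC[n∸k] {0} {n} z≤n) (nCn≡1 n)

  ∑-below : ∀ {n} (F : Family n) A g → ∑ (members (below F A)) g ≡ ∑ₛ (λ B → 𝟙 (ssub B A) * (𝟙 (F B) * g B))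
  ∑-below {n} F A g = trans (∑-members (below F A) g) (∑-cong (allSubsets n) (λ {B} _ →
    trans (cong (_* g B) (𝟙-∧ (F B) (ssub B A))) (rearrange (𝟙 (F B)) (𝟙 (ssub B A)) (g B))))
    where
    rearrange : ∀ a b c → a * b * c ≡ b * (a * c)
    rearrange = solve-∀

  -- Maximal chains through a given chain

  -- The weight of a chain depends only on the sizes of its members, so a chain is recorded as its
  -- descending list of sizes, with one entry per chain.
  profiles : ∀ {n} → Family n → ℕ → Subset n → List (List ℕ)
  profilesFrom : ∀ {n} → Family n → ℕ → List (Subset n) → List (List ℕ)
  profiles F zero    A = [ [] ]
  profiles F (suc k) A = profilesFrom F k (members (below F A))
  profilesFrom F k = concatMap (λ B → map (∣ B ∣ ∷_) (profiles F k B))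

  ∑-profilesFrom : ∀ {n} (F : Family n) k xs φ →
    ∑ (profilesFrom F k xs) φ ≡ ∑ xs (λ B → ∑ (profiles F k B) (φ ∘ (∣ B ∣ ∷_)))
  ∑-profilesFrom F k xs φ = trans (∑-concatMap _ xs φ)
    (∑-cong xs (λ {B} _ → ∑-map (∣ B ∣ ∷_) (profiles F k B) φ))

  chainsBelow≡∑ : ∀ {n} (F : Family n) k A → chainsBelow F k A ≡ ∑ (profiles F k A) (λ _ → 1)
  chainsBelow≡∑ F zero    A = refl
  chainsBelow≡∑ F (suc k) A = trans (∑-cong (members (below F A)) (λ {B} _ → chainsBelow≡∑ F k B))
    (sym (∑-profilesFrom F k (members (below F A)) _))

  copies≡∑ : ∀ {n} (F : Family n) k → copies (suc k) F ≡ ∑ (profilesFrom F k (members F)) (λ _ → 1)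
  copies≡∑ F k = trans (copies-suc k F) (trans (∑-cong (members F) (λ {B} _ → chainsBelow≡∑ F k B))
    (sym (∑-profilesFrom F k (members F) _)))

  -- The number of maximal chains below a set of size a through a given chain with sizes bs.
  refinements : ℕ → List ℕ → ℕ
  refinements a []       = a !
  refinements a (b ∷ bs) = (a ∸ b) ! * refinements b bs

  -- One entry per maximal chain from A, of size a, down to ∅: its number of members of F
  -- other than A.
  counts : ∀ {n} → Family n → ℕ → Subset n → List ℕ
  counts F zero    A = [ 0 ]
  counts F (suc a) A = concatMap (λ B → map (𝟙 (F B) +_) (counts F a B)) (covers A)

  ∑-counts-suc : ∀ {n} (F : Family n) a A φ →
    ∑ (counts F (suc a) A) φ ≡ ∑ (covers A) (λ B → ∑ (counts F a B) (φ ∘ (𝟙 (F B) +_)))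
  ∑-counts-suc F a A φ = trans (∑-concatMap _ (covers A) φ)
    (∑-cong (covers A) (λ {B} _ → ∑-map (𝟙 (F B) +_) (counts F a B) φ))

  length-counts : ∀ {n} (F : Family n) a A → ∣ A ∣ ≡ a → ∑ (counts F a A) (λ _ → 1) ≡ a !
  length-counts F zero    A p = refl
  length-counts F (suc a) A p = begin
    ∑ (counts F (suc a) A) (λ _ → 1)                  ≡⟨ ∑-counts-suc F a A _ ⟩
    ∑ (covers A) (λ B → ∑ (counts F a B) (λ _ → 1))   ≡⟨ ∑-cong (covers A) (λ {B} B∈ →
       length-counts F a B (suc-injective (trans (∈-covers-size A B∈) p))) ⟩
    ∑ (covers A) (λ _ → a !)                          ≡⟨ ∑-const (covers A) (a !) ⟩
    length (covers A) * a !                           ≡⟨ cong (_* a !) (trans (length-covers A) p) ⟩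
    suc a ! ∎
    where open ≡-Reasoning

  ∑-sub : ∀ {n} (A : Subset n) (g : Subset n → ℕ) → ∑ₛ (λ B → 𝟙 (sub B A) * g B) ≡ ∑ₛ (λ B → 𝟙 (ssub B A) * g B) + g A
  ∑-sub []            g = trans (+-identityʳ _) (+-identityʳ _)
  ∑-sub (inside ∷ A)  g
    rewrite ∑ₛ-suc (λ B → 𝟙 (sub B (inside ∷ A)) * g B)
          | ∑ₛ-suc (λ B → 𝟙 (ssub B (inside ∷ A)) * g B)
          | ∑-sub A (g ∘ (inside ∷_)) = rearrange (∑ₛ (λ B → 𝟙 (ssub B A) * g (inside ∷ B))) (g (inside ∷ A)) _
    where
    rearrange : ∀ a b c → a + b + c ≡ a + c + b
    rearrange = solve-∀
  ∑-sub (outside ∷ A) g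
    rewrite ∑ₛ-suc (λ B → 𝟙 (sub B (outside ∷ A)) * g B)
          | ∑ₛ-suc (λ B → 𝟙 (ssub B (outside ∷ A)) * g B)
          | ∑-sub A (g ∘ (outside ∷_)) = sym (+-assoc (∑ₛ (λ B → 0 * g (inside ∷ B))) _ _)

  -- Pascal's rule: a selection of `suc k` members either avoids the top set or consists of it and
  -- `k` others.
  ∑-counts-𝟙+ : ∀ {n} (F : Family n) a k A b →
    ∑ (counts F a A) (λ t → (𝟙 b + t) C suc k) ≡ ∑ (counts F a A) (_C suc k) + 𝟙 b * ∑ (counts F a A) (_C k)
  ∑-counts-𝟙+ F a k A false = sym (+-identityʳ _)
  ∑-counts-𝟙+ F a k A true  = begin
    ∑ (counts F a A) (λ t → suc t C suc k)           ≡⟨ ∑-cong (counts F a A) (λ {t} _ →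
       trans (sym (nCk+nC[k+1]≡[n+1]C[k+1] t k)) (+-comm (t C k) _)) ⟩
    ∑ (counts F a A) (λ t → t C suc k + t C k)       ≡⟨ ∑-+ (counts F a A) _ _ ⟩
    ∑ (counts F a A) (_C suc k) + ∑ (counts F a A) (_C k)
      ≡⟨ cong (∑ (counts F a A) (_C suc k) +_) (+-identityʳ _) ⟨
    ∑ (counts F a A) (_C suc k) + 1 * ∑ (counts F a A) (_C k) ∎
    where open ≡-Reasoning

  -- The ways to continue below `B`, as the largest selected member: a maximal chain from `B` down
  -- together with `k` of its lower members in `F`.
  throughs : ∀ {n} → Family n → ℕ → Subset n → ℕ
  throughs F k B = 𝟙 (F B) * ∑ (counts F ∣ B ∣ B) (_C k)

  -- Selections of `suc k` members on maximal chains below `A` are sorted by their largest member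
  -- `B`; a maximal chain gets from `A` to `B` in `(a ∸ ∣ B ∣) !` ways.
  ∑-counts-C : ∀ {n} (F : Family n) k a A → ∣ A ∣ ≡ a →
    ∑ (counts F a A) (_C suc k) ≡ ∑ₛ (λ B → 𝟙 (ssub B A) * ((a ∸ ∣ B ∣) ! * throughs F k B))
  ∑-counts-C-top : ∀ {n} (F : Family n) k a A → ∣ A ∣ ≡ a →
    ∑ (counts F a A) (λ t → (𝟙 (F A) + t) C suc k) ≡ ∑ₛ (λ B → 𝟙 (sub B A) * ((a ∸ ∣ B ∣) ! * throughs F k B))
  ∑-counts-C F k zero    A p = sym (∑-zero (allSubsets _) (λ {B} _ → vanish B))
    where
    vanish : ∀ B → 𝟙 (ssub B A) * ((0 ∸ ∣ B ∣) ! * throughs F k B) ≡ 0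
    vanish B with ssub B A in q
    ... | false = refl
    ... | true with subst (∣ B ∣ <_) p (ssub-size B A q)
    ... | ()
  ∑-counts-C {n} F k (suc a) A p = begin
    ∑ (counts F (suc a) A) (_C suc k)
      ≡⟨ ∑-counts-suc F a A _ ⟩
    ∑ (covers A) (λ A′ → ∑ (counts F a A′) (λ t → (𝟙 (F A′) + t) C suc k))
      ≡⟨ ∑-cong (covers A) (λ {A′} A′∈ → ∑-counts-C-top F k a A′ (suc-injective (trans (∈-covers-size A A′∈) p))) ⟩
    ∑ (covers A) (λ A′ → ∑ₛ (λ B → 𝟙 (sub B A′) * ((a ∸ ∣ B ∣) ! * throughs F k B)))
      ≡⟨ ∑-swap (covers A) (allSubsets n) _ ⟩
    ∑ₛ (λ B → ∑ (covers A) (λ A′ → 𝟙 (sub B A′) * ((a ∸ ∣ B ∣) ! * throughs F k B)))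
      -- Each of the `∣ A ∣ ∸ ∣ B ∣` covers containing `B` contributes the same factorial, which
      -- raises it to the next one.
      ≡⟨ ∑-cong (allSubsets n) (λ {B} _ → trans (∑-*ʳ (covers A) _ (𝟙 ∘ sub B)) (trans (cong (_* ((a ∸ ∣ B ∣) ! * throughs F k B)) (∑-covers-sub B A)) (absorb B))) ⟩
    ∑ₛ (λ B → 𝟙 (ssub B A) * ((suc a ∸ ∣ B ∣) ! * throughs F k B)) ∎
    where
    open ≡-Reasoning
    absorb : ∀ B → 𝟙 (ssub B A) * (∣ A ∣ ∸ ∣ B ∣) * ((a ∸ ∣ B ∣) ! * throughs F k B) ≡
             𝟙 (ssub B A) * ((suc a ∸ ∣ B ∣) ! * throughs F k B)
    absorb B with ssub B A in q
    ... | false = refl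
    ... | true rewrite p | +-∸-assoc 1 (≤-pred (subst (∣ B ∣ <_) p (ssub-size B A q))) =
      rearrange (a ∸ ∣ B ∣) ((a ∸ ∣ B ∣) !) (throughs F k B)
      where
      rearrange : ∀ d f t → 1 * suc d * (f * t) ≡ 1 * (suc d * f * t)
      rearrange = solve-∀
  ∑-counts-C-top F k a A p = begin
    ∑ (counts F a A) (λ t → (𝟙 (F A) + t) C suc k)
      ≡⟨ ∑-counts-𝟙+ F a k A (F A) ⟩
    ∑ (counts F a A) (_C suc k) + 𝟙 (F A) * ∑ (counts F a A) (_C k)
      ≡⟨ cong₂ _+_ (∑-counts-C F k a A p) (sym self) ⟩
    ∑ₛ (λ B → 𝟙 (ssub B A) * ((a ∸ ∣ B ∣) ! * throughs F k B)) + (a ∸ ∣ A ∣) ! * throughs F k A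
      ≡⟨ ∑-sub A (λ B → (a ∸ ∣ B ∣) ! * throughs F k B) ⟨
    ∑ₛ (λ B → 𝟙 (sub B A) * ((a ∸ ∣ B ∣) ! * throughs F k B)) ∎
    where
    open ≡-Reasoning
    self : (a ∸ ∣ A ∣) ! * throughs F k A ≡ 𝟙 (F A) * ∑ (counts F a A) (_C k)
    self rewrite p | n∸n≡0 a = +-identityʳ _

  -- `∑-counts-C` iterated: peeling off the selected members one by one leaves the factorials of the
  -- gaps, whose product is `refinements`.
  ∑-counts≡∑-profiles : ∀ {n} (F : Family n) k A →
    ∑ (counts F ∣ A ∣ A) (_C k) ≡ ∑ (profiles F k A) (refinements ∣ A ∣)
  ∑-throughs : ∀ {n} (F : Family n) k a (xs : List (Subset n)) →
    ∑ xs (λ B → (a ∸ ∣ B ∣) ! * ∑ (counts F ∣ B ∣ B) (_C k)) ≡ ∑ (profilesFrom F k xs) (refinements a)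
  ∑-counts≡∑-profiles F zero    A = trans (∑-cong (counts F ∣ A ∣ A) (λ {t} _ → nC0≡1 t))
    (trans (length-counts F ∣ A ∣ A refl) (sym (+-identityʳ _)))
  ∑-counts≡∑-profiles {n} F (suc k) A = trans (∑-counts-C F k ∣ A ∣ A refl)
    (trans (∑-cong (allSubsets n) (λ {B} _ → cong (𝟙 (ssub B A) *_) (rearrange ((∣ A ∣ ∸ ∣ B ∣) !) (𝟙 (F B)) (∑ (counts F ∣ B ∣ B) (_C k)))))
    (trans (sym (∑-below F A _)) (∑-throughs F k ∣ A ∣ (members (below F A)))))
    where
    rearrange : ∀ a b c → a * (b * c) ≡ b * (a * c)
    rearrange = solve-∀
  ∑-throughs F k a xs = trans
    (∑-cong xs (λ {B} _ → trans (cong ((a ∸ ∣ B ∣) ! *_) (∑-counts≡∑-profiles F k B)) (sym (∑-*ˡ (profiles F k B) ((a ∸ ∣ B ∣) !) (refinements ∣ B ∣)))))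
    (sym (∑-profilesFrom F k xs (refinements a)))

  sub-⊤ : ∀ {n} (A : Subset n) → sub A ⊤ ≡ true
  sub-⊤ []            = refl
  sub-⊤ (inside ∷ A)  = sub-⊤ A
  sub-⊤ (outside ∷ A) = sub-⊤ A

  -- One entry per maximal chain of the whole lattice.
  intersections : ∀ {n} → Family n → List ℕ
  intersections {n} F = map (𝟙 (F ⊤) +_) (counts F n ⊤)

  ∑-intersections-1 : ∀ {n} (F : Family n) → ∑ (intersections F) (λ _ → 1) ≡ n !
  ∑-intersections-1 {n} F = trans (∑-map _ (counts F n ⊤) _) (length-counts F n ⊤ (∣⊤∣≡n n))

  -- Double counting of pairs of a maximal chain and a chain of `suc k` members of `F` on it.
  ∑-intersections-C : ∀ {n} (F : Family n) k →
    ∑ (intersections F) (_C suc k) ≡ ∑ (profilesFrom F k (members F)) (refinements n)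
  ∑-intersections-C {n} F k = trans (∑-map _ (counts F n ⊤) _) (trans (∑-counts-C-top F k n ⊤ (∣⊤∣≡n n))
    (trans (∑-cong (allSubsets n) (λ {B} _ → trans (cong (λ b → 𝟙 b * ((n ∸ ∣ B ∣) ! * throughs F k B)) (sub-⊤ B))
      (rearrange ((n ∸ ∣ B ∣) !) (𝟙 (F B)) (∑ (counts F ∣ B ∣ B) (_C k)))))
    (trans (sym (∑-members F _)) (∑-throughs F k n (members F)))))
    where
    rearrange : ∀ a b c → 1 * (a * (b * c)) ≡ b * (a * c)
    rearrange = solve-∀

  -- A maximal chain has one set of each size. `A` itself is not counted, so the sizes run from `lo`
  -- to the smaller of `a − 1` and `hi`; the companion that counts `A` has `suc a` instead.
  counts-bound : ∀ {n} (F : Family n) lo hi → (∀ A → F A ≡ true → lo ≤ ∣ A ∣ × ∣ A ∣ ≤ hi) →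
    ∀ a A → ∣ A ∣ ≡ a → ∀ {t} → t ∈ counts F a A → t ≤ (a ⊓ suc hi) ∸ lo
  counts-bound-step : ∀ {n} (F : Family n) lo hi → (∀ A → F A ≡ true → lo ≤ ∣ A ∣ × ∣ A ∣ ≤ hi) →
    ∀ a A → ∣ A ∣ ≡ a → ∀ {t} → t ∈ map (𝟙 (F A) +_) (counts F a A) → t ≤ (suc a ⊓ suc hi) ∸ lo
  counts-bound F lo hi bd zero    A p (here refl) = z≤n
  counts-bound F lo hi bd (suc a) A p t∈ with find (∈-concatMap⁻ (λ B → map (𝟙 (F B) +_) (counts F a B)) {xs = covers A} t∈)
  ... | B , B∈ , t∈′ = counts-bound-step F lo hi bd a B (suc-injective (trans (∈-covers-size A B∈) p)) t∈′
  counts-bound-step F lo hi bd a A p t∈ with ∈-map⁻ (𝟙 (F A) +_) t∈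
  ... | t , t∈′ , refl with F A in q | counts-bound F lo hi bd a A p t∈′
  ... | false | t≤ = ≤-trans t≤ (∸-monoˡ-≤ lo (⊓-monoˡ-≤ (suc hi) (n≤1+n a)))
  ... | true  | t≤ with bd A q
  ... | lo≤ , ≤hi rewrite p | m≤n⇒m⊓n≡m (m≤n⇒m≤1+n ≤hi) | m≤n⇒m⊓n≡m (s≤s ≤hi) =
    ≤-trans (s≤s t≤) (≤-reflexive (sym (+-∸-assoc 1 lo≤)))

  intersections-bound : ∀ {n} (F : Family n) lo hi → (∀ A → F A ≡ true → lo ≤ ∣ A ∣ × ∣ A ∣ ≤ hi) →
    ∀ {t} → t ∈ intersections F → t ≤ suc hi ∸ lo
  intersections-bound {n} F lo hi bd t∈ =
    ≤-trans (counts-bound-step F lo hi bd n ⊤ (∣⊤∣≡n n) t∈) (∸-monoˡ-≤ lo (m⊓n≤n (suc n) (suc hi)))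

  onSizes : ∀ {n} → (ℕ → Bool) → Family n → Family n
  onSizes r F A = F A ∧ r ∣ A ∣

  allSizes : (ℕ → Bool) → List ℕ → ℕ
  allSizes r []       = 1
  allSizes r (b ∷ bs) = 𝟙 (r b) * allSizes r bs

  -- Turns the restriction to some sizes into a 0/1 factor on the chains of the unrestricted `F`, so
  -- that sums over different truncations run over the same chains and can be exchanged.
  ∑-profiles-onSizes : ∀ {n} (F : Family n) r k A φ →
    ∑ (profiles (onSizes r F) k A) φ ≡ ∑ (profiles F k A) (λ s → allSizes r s * φ s)
  ∑-profilesFrom-onSizes : ∀ {n} (F : Family n) r k (xs : List (Subset n)) φ →
    ∑ xs (λ B → 𝟙 (r ∣ B ∣) * ∑ (profiles (onSizes r F) k B) (φ ∘ (∣ B ∣ ∷_))) ≡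
    ∑ (profilesFrom F k xs) (λ s → allSizes r s * φ s)
  ∑-profiles-onSizes F r zero    A φ = cong (_+ 0) (sym (+-identityʳ _))
  ∑-profiles-onSizes {n} F r (suc k) A φ = begin
    ∑ (profiles (onSizes r F) (suc k) A) φ
      ≡⟨ ∑-profilesFrom (onSizes r F) k (members (below (onSizes r F) A)) φ ⟩
    ∑ (members (below (onSizes r F) A)) g
      ≡⟨ ∑-below (onSizes r F) A g ⟩
    ∑ₛ (λ B → 𝟙 (ssub B A) * (𝟙 (F B ∧ r ∣ B ∣) * g B))
      ≡⟨ ∑-cong (allSubsets n) (λ {B} _ → cong (𝟙 (ssub B A) *_) (trans (cong (_* g B) (𝟙-∧ (F B) _)) (*-assoc (𝟙 (F B)) _ _))) ⟩
    ∑ₛ (λ B → 𝟙 (ssub B A) * (𝟙 (F B) * (𝟙 (r ∣ B ∣) * g B)))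
      ≡⟨ ∑-below F A _ ⟨
    ∑ (members (below F A)) (λ B → 𝟙 (r ∣ B ∣) * g B)
      ≡⟨ ∑-profilesFrom-onSizes F r k (members (below F A)) φ ⟩
    ∑ (profiles F (suc k) A) (λ s → allSizes r s * φ s) ∎
    where
    open ≡-Reasoning
    g : Subset n → ℕ
    g B = ∑ (profiles (onSizes r F) k B) (φ ∘ (∣ B ∣ ∷_))
  ∑-profilesFrom-onSizes F r k xs φ = trans
    (∑-cong xs (λ {B} _ → trans (cong (𝟙 (r ∣ B ∣) *_) (∑-profiles-onSizes F r k B _))
      (trans (sym (∑-*ˡ (profiles F k B) (𝟙 (r ∣ B ∣)) (λ s → allSizes r s * φ (∣ B ∣ ∷ s)))) (∑-cong (profiles F k B) (λ _ → sym (*-assoc (𝟙 (r ∣ B ∣)) _ _))))))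
    (sym (∑-profilesFrom F k xs _))

  ∑-allProfiles-onSizes : ∀ {n} (F : Family n) r k φ →
    ∑ (profilesFrom (onSizes r F) k (members (onSizes r F))) φ ≡
    ∑ (profilesFrom F k (members F)) (λ s → allSizes r s * φ s)
  ∑-allProfiles-onSizes {n} F r k φ = begin
    ∑ (profilesFrom (onSizes r F) k (members (onSizes r F))) φ
      ≡⟨ ∑-profilesFrom (onSizes r F) k (members (onSizes r F)) φ ⟩
    ∑ (members (onSizes r F)) g
      ≡⟨ ∑-members (onSizes r F) g ⟩
    ∑ₛ (λ B → 𝟙 (F B ∧ r ∣ B ∣) * g B)
      ≡⟨ ∑-cong (allSubsets n) (λ {B} _ → trans (cong (_* g B) (𝟙-∧ (F B) _)) (*-assoc (𝟙 (F B)) _ _)) ⟩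
    ∑ₛ (λ B → 𝟙 (F B) * (𝟙 (r ∣ B ∣) * g B))
      ≡⟨ ∑-members F _ ⟨
    ∑ (members F) (λ B → 𝟙 (r ∣ B ∣) * g B)
      ≡⟨ ∑-profilesFrom-onSizes F r k (members F) φ ⟩
    ∑ (profilesFrom F k (members F)) (λ s → allSizes r s * φ s) ∎
    where
    open ≡-Reasoning
    g : Subset n → ℕ
    g B = ∑ (profiles (onSizes r F) k B) (φ ∘ (∣ B ∣ ∷_))

  profiles-shape : ∀ {n} (F : Family n) k A {s} → s ∈ profiles F k A → Linked _>_ (∣ A ∣ ∷ s) × length s ≡ k
  profiles-shape F zero    A (here refl) = [-] , refl
  profiles-shape F (suc k) A s∈
    with find (∈-concatMap⁻ (λ B → map (∣ B ∣ ∷_) (profiles F k B)) {xs = members (below F A)} s∈)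
  ... | B , B∈ , s∈′ with ∈-map⁻ (∣ B ∣ ∷_) s∈′ | ∧-true (F B) (ssub B A) (∈-members (below F A) B∈)
  ... | s , s∈″ , refl | _ , B<A with profiles-shape F k B s∈″
  ... | linked , len = ssub-size B A B<A ∷ linked , cong suc len

  allProfiles-shape : ∀ {n} (F : Family n) k {s} → s ∈ profilesFrom F k (members F) →
    ∃ λ A → ∃ λ bs → s ≡ ∣ A ∣ ∷ bs × F A ≡ true × Linked _>_ (∣ A ∣ ∷ bs) × length bs ≡ k
  allProfiles-shape F k s∈
    with find (∈-concatMap⁻ (λ B → map (∣ B ∣ ∷_) (profiles F k B)) {xs = members F} s∈)
  ... | B , B∈ , s∈′ with ∈-map⁻ (∣ B ∣ ∷_) s∈′
  ... | s , s∈″ , refl with profiles-shape F k B s∈″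
  ... | linked , len = B , s , refl , ∈-members F B∈ , linked , len

  -- Boolean comparisons and halves of natural numbers

  ≤ᵇ-true : ∀ {m n} → m ≤ n → (m ≤ᵇ n) ≡ true
  ≤ᵇ-true {m} {n} p with m ≤ᵇ n | ≤⇒≤ᵇ p
  ... | true | _ = refl

  ≤ᵇ-true⁻ : ∀ {m n} → (m ≤ᵇ n) ≡ true → m ≤ n
  ≤ᵇ-true⁻ {m} {n} p = ≤ᵇ⇒≤ m n (subst T (sym p) _)

  ≤ᵇ-false : ∀ {m n} → n < m → (m ≤ᵇ n) ≡ false
  ≤ᵇ-false {m} {n} p with m ≤ᵇ n in q
  ... | false = refl
  ... | true  = ⊥-elim (<⇒≱ p (≤ᵇ-true⁻ q))

  ≤ᵇ-cong : ∀ {a b c d} → (a ≤ b → c ≤ d) → (c ≤ d → a ≤ b) → (a ≤ᵇ b) ≡ (c ≤ᵇ d)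
  ≤ᵇ-cong {a} {b} {c} {d} f g with a ≤ᵇ b in p | c ≤ᵇ d in q
  ... | true  | true  = refl
  ... | false | false = refl
  ... | true  | false = trans (sym (≤ᵇ-true (f (≤ᵇ-true⁻ p)))) q
  ... | false | true  = trans (sym p) (≤ᵇ-true (g (≤ᵇ-true⁻ q)))

  ≡ᵇ-true : ∀ {m n} → m ≡ n → (m ≡ᵇ n) ≡ true
  ≡ᵇ-true {m} {n} p with m ≡ᵇ n | ≡⇒≡ᵇ m n p
  ... | true | _ = refl

  ≡ᵇ-false : ∀ {m n} → m ≢ n → (m ≡ᵇ n) ≡ false
  ≡ᵇ-false {m} {n} p with m ≡ᵇ n | ≡ᵇ⇒≡ m n
  ... | false | _ = refl
  ... | true  | q = ⊥-elim (p (q _))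

  m+m≤n⇒m≤⌊n/2⌋ : ∀ {m n} → m + m ≤ n → m ≤ ⌊ n /2⌋
  m+m≤n⇒m≤⌊n/2⌋ {m} p = ≤-trans (≤-reflexive (n≡⌊n+n/2⌋ m)) (⌊n/2⌋-mono p)

  m≤n+n⇒⌈m/2⌉≤n : ∀ {m n} → m ≤ n + n → ⌈ m /2⌉ ≤ n
  m≤n+n⇒⌈m/2⌉≤n {n = n} p = ≤-trans (⌈n/2⌉-mono p) (≤-reflexive (sym (n≡⌈n+n/2⌉ n)))

  ⌊n/2⌋+⌊n/2⌋≤n : ∀ n → ⌊ n /2⌋ + ⌊ n /2⌋ ≤ n
  ⌊n/2⌋+⌊n/2⌋≤n n = ≤-trans (+-monoʳ-≤ ⌊ n /2⌋ (⌊n/2⌋≤⌈n/2⌉ n)) (≤-reflexive (⌊n/2⌋+⌈n/2⌉≡n n))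

  -- Falling factorials, factorials and binomial coefficients

  fall : ℕ → ℕ → ℕ
  fall m zero    = 1
  fall m (suc j) = fall m j * (m ∸ j)

  fall-suc : ∀ m j → fall (suc m) (suc j) ≡ suc m * fall m j
  fall-suc m zero    = *-comm 1 (suc m)
  fall-suc m (suc j) = trans (cong (_* (m ∸ j)) (fall-suc m j)) (*-assoc (suc m) (fall m j) (m ∸ j))

  fall-mono : ∀ {m m′} j → m ≤ m′ → fall m j ≤ fall m′ j
  fall-mono zero    p = ≤-refl
  fall-mono (suc j) p = *-mono-≤ (fall-mono j p) (∸-monoˡ-≤ j p)

  fall-! : ∀ j r → fall (j + r) j * r ! ≡ (j + r) !
  fall-! zero    r = +-identityʳ _
  fall-! (suc j) r = trans (cong (_* r !) (fall-suc (j + r) j))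
    (trans (*-assoc (suc (j + r)) (fall (j + r) j) (r !)) (cong (suc (j + r) *_) (fall-! j r)))

  -- Merging two positive parts saves one unit of their sum. These saved units are what the falling
  -- factorial later fills.
  !*!≤! : ∀ p q → suc p ! * suc q ! ≤ suc (p + q) !
  !*!≤! zero    q = ≤-reflexive (+-identityʳ _)
  !*!≤! (suc p) q = begin
    suc (suc p) * suc p ! * suc q !   ≡⟨ *-assoc (suc (suc p)) (suc p !) _ ⟩
    suc (suc p) * (suc p ! * suc q !) ≤⟨ *-mono-≤ (s≤s (s≤s (m≤m+n p q))) (!*!≤! p q) ⟩
    suc (suc (p + q)) * suc (p + q) ! ∎
    where open ≤-Reasoning

  nCk*k!*[n∸k]!≡n! : ∀ {n k} → k ≤ n → (n C k) * (k ! * (n ∸ k) !) ≡ n !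
  nCk*k!*[n∸k]!≡n! {n} {k} k≤n = trans (cong (_* (k ! * (n ∸ k) !)) (nCk≡n!/k![n-k]! k≤n))
    (m/n*n≡m (k![n∸k]!∣n! k≤n))
    where instance _ = k !* (n ∸ k) !≢0

  1≤nCk : ∀ n k → k ≤ n → 1 ≤ n C k
  1≤nCk n k k≤n with n C k | nCk*k!*[n∸k]!≡n! k≤n
  ... | suc _ | _ = s≤s z≤n
  ... | zero  | p = ⊥-elim (<⇒≢ (1≤n! n) p)

  n≤nCk : ∀ n k → 0 < k → k < n → n ≤ n C k
  n≤nCk (suc n) (suc zero)    _ _         = ≤-reflexive (sym (nC1≡n (suc n)))
  n≤nCk (suc n) (suc (suc k)) _ (s≤s k<n) = begin
    suc n                             ≡⟨ +-comm 1 n ⟩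
    n + 1                             ≤⟨ +-mono-≤ (n≤nCk n (suc k) (s≤s z≤n) k<n) (1≤nCk n (suc (suc k)) k<n) ⟩
    n C suc k + n C suc (suc k)       ≡⟨ nCk+nC[k+1]≡[n+1]C[k+1] n (suc k) ⟩
    suc n C suc (suc k)               ∎
    where open ≤-Reasoning

  -- Both `(n C j) * suc d` and `(n C suc j) * suc j` equal `n !` divided by `j ! * d !`, and
  -- `j ≤ d`.
  C-unimodal : ∀ n j → suc j + suc j ≤ n → n C j ≤ n C suc j
  C-unimodal n j p = *-cancelʳ-≤ (n C j) (n C suc j) (suc j) (begin
    (n C j) * suc j     ≤⟨ *-monoʳ-≤ (n C j) (s≤s j≤d) ⟩
    (n C j) * suc d     ≡⟨ *-cancelʳ-≡ _ _ (j ! * d !) {{j !* d !≢0}} absorption ⟩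
    (n C suc j) * suc j ∎)
    where
    open ≤-Reasoning
    d = n ∸ suc j
    j<n : suc j ≤ n
    j<n = ≤-trans (m≤m+n (suc j) (suc j)) p
    j≤d : j ≤ d
    j≤d = ≤-trans (n≤1+n j) (≤-trans (≤-reflexive (sym (m+n∸m≡n (suc j) (suc j)))) (∸-monoˡ-≤ (suc j) p))
    n∸j : n ∸ j ≡ suc d
    n∸j = +-∸-assoc 1 j<n
    left : ∀ a x y s → a * s * (x * y) ≡ a * (x * (s * y))
    left = solve-∀
    right : ∀ a x y s → a * s * (x * y) ≡ a * (s * x * y)
    right = solve-∀
    absorption : (n C j) * suc d * (j ! * d !) ≡ (n C suc j) * suc j * (j ! * d !)
    absorption = trans (left (n C j) (j !) (d !) (suc d)) (trans (cong (λ z → (n C j) * (j ! * z !)) (sym n∸j))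
      (trans (nCk*k!*[n∸k]!≡n! (<⇒≤ j<n)) (trans (sym (nCk*k!*[n∸k]!≡n! j<n)) (sym (right (n C suc j) (j !) (d !) (suc j))))))

  -- By Pascal's rule, each element after the first `k` adds at least one selection of `suc k`
  -- elements.
  t≤tC[k+1]+k : ∀ t k → t ≤ t C suc k + k
  t≤tC[k+1]+k zero    k = z≤n
  t≤tC[k+1]+k (suc t) k with suc t ≤? k
  ... | yes p = ≤-trans p (m≤n+m k (suc t C suc k))
  ... | no ¬p = begin
    suc t                    ≤⟨ +-mono-≤ (1≤nCk t k (≤-pred (≰⇒> ¬p))) (t≤tC[k+1]+k t k) ⟩
    t C k + (t C suc k + k)  ≡⟨ +-assoc (t C k) _ _ ⟨
    t C k + t C suc k + k    ≡⟨ cong (_+ k) (nCk+nC[k+1]≡[n+1]C[k+1] t k) ⟩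
    suc t C suc k + k        ∎
    where open ≤-Reasoning

  -- The weights of the symmetric chains

  weight : ℕ → ℕ → ℕ
  weight n zero    = 1
  weight n (suc j) = n C suc j ∸ n C j

  halfRange : ℕ → List ℕ
  halfRange n = downFrom (suc ⌊ n /2⌋)

  -- A telescoping sum; unimodality below the middle makes the truncated differences exact.
  ∑-weight-all : ∀ n J → J + J ≤ n → ∑ (downFrom (suc J)) (weight n) ≡ n C J
  ∑-weight-all n zero    p = sym (nC0≡1 n)
  ∑-weight-all n (suc J) p = trans
    (cong (weight n (suc J) +_) (∑-weight-all n J (≤-trans (+-mono-≤ (n≤1+n J) (n≤1+n J)) p)))
    (m∸n+n≡m (C-unimodal n J p))

  ∑-weight-downTo : ∀ n J h → J + J ≤ n → J ≤′ h → ∑ (downFrom (suc h)) (λ j → weight n j * 𝟙 (j ≤ᵇ J)) ≡ n C J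
  ∑-weight-downTo n J .J p ≤′-refl = trans (∑-cong (downFrom (suc J)) (λ {j} j∈ →
    trans (cong (λ b → weight n j * 𝟙 b) (≤ᵇ-true (≤-pred (∈-downFrom⁻ j∈)))) (*-identityʳ _))) (∑-weight-all n J p)
  ∑-weight-downTo n J (suc h) p (≤′-step q) =
    cong₂ _+_ (trans (cong (λ b → weight n (suc h) * 𝟙 b) (≤ᵇ-false (s≤s (≤′⇒≤ q)))) (*-zeroʳ (weight n (suc h))))
      (∑-weight-downTo n J h p q)

  ∑-weight : ∀ n J → J + J ≤ n → ∑ (halfRange n) (λ j → weight n j * 𝟙 (j ≤ᵇ J)) ≡ n C J
  ∑-weight n J p = ∑-weight-downTo n J ⌊ n /2⌋ p (≤⇒≤′ (m+m≤n⇒m≤⌊n/2⌋ p))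

  symmetric : ℕ → ℕ → ℕ → Bool
  symmetric n j b = (j ≤ᵇ b) ∧ (b ≤ᵇ n ∸ j)

  ∈-halfRange : ∀ n {j} → j ∈ halfRange n → j + j ≤ n
  ∈-halfRange n j∈ = ≤-trans (+-mono-≤ j≤ j≤) (⌊n/2⌋+⌊n/2⌋≤n n)
    where
    j≤ = ≤-pred (∈-downFrom⁻ j∈)

  ∧-≤ᵇ : ∀ {a b c d e f} → (a ≤ b → c ≤ d → e ≤ f) → (e ≤ f → a ≤ b) → (e ≤ f → c ≤ d) →
    (a ≤ᵇ b) ∧ (c ≤ᵇ d) ≡ (e ≤ᵇ f)
  ∧-≤ᵇ {a} {b} {c} {d} {e} {f} i g h with e ≤ᵇ f in p
  ... | true rewrite ≤ᵇ-true (g (≤ᵇ-true⁻ p)) | ≤ᵇ-true (h (≤ᵇ-true⁻ p)) = refl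
  ... | false with a ≤ᵇ b in q | c ≤ᵇ d in r
  ... | true  | true  = trans (sym (≤ᵇ-true (i (≤ᵇ-true⁻ q) (≤ᵇ-true⁻ r)))) p
  ... | true  | false = refl
  ... | false | _     = refl

  -- The size `b` survives the truncation at `j` exactly when `j` is at most both `b` and `n ∸ b`.
  -- The smaller of these lies in the lower half, where the weights telescope, and symmetry of the
  -- binomial coefficient covers the larger.
  ∑-weight-symmetric : ∀ n b → b ≤ n → ∑ (halfRange n) (λ j → weight n j * 𝟙 (symmetric n j b)) ≡ n C b
  ∑-weight-symmetric n b b≤n with ≤-total (b + b) n
  ... | inj₁ 2b≤n = trans (∑-cong (halfRange n) (λ {j} _ → cong (λ z → weight n j * 𝟙 z)
        (∧-≤ᵇ {j} {b} {b} {n ∸ j} {j} {b} (λ j≤b _ → j≤b) (λ j≤b → j≤b) (λ j≤b → ≤-trans b≤n∸b (∸-monoʳ-≤ n j≤b))))) (∑-weight n b 2b≤n)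
    where
    b≤n∸b : b ≤ n ∸ b
    b≤n∸b = m+n≤o⇒m≤o∸n b 2b≤n
  ... | inj₂ n≤2b = trans (∑-cong (halfRange n) (λ {j} j∈ → cong (λ z → weight n j * 𝟙 z)
        (∧-≤ᵇ {j} {b} {b} {n ∸ j} {j} {n ∸ b} (λ _ b≤n∸j → flip {j} (≤-trans (m≤m+n j j) (∈-halfRange n j∈)) b≤n∸j)
              (λ j≤n∸b → ≤-trans j≤n∸b (m≤n+o⇒m∸n≤o n b n≤2b))
              (λ j≤n∸b → flip {b} b≤n j≤n∸b))))
      (trans (∑-weight n (n ∸ b) small) (sym (nCk≡nC[n∸k] b≤n)))
    where
    flip : ∀ {x y} → x ≤ n → y ≤ n ∸ x → x ≤ n ∸ y
    flip {x} {y} x≤n p = m+n≤o⇒m≤o∸n x (≤-trans (≤-reflexive (+-comm x y)) (m≤n∸o⇒m+o≤n x≤n p))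
      where
      m≤n∸o⇒m+o≤n : ∀ {m n o} → o ≤ n → m ≤ n ∸ o → m + o ≤ n
      m≤n∸o⇒m+o≤n {m} {n} {o} o≤n q = ≤-trans (+-monoˡ-≤ o q) (≤-reflexive (m∸n+n≡m o≤n))
    small : (n ∸ b) + (n ∸ b) ≤ n
    small = ≤-trans (+-monoʳ-≤ (n ∸ b) (m≤n+o⇒m∸n≤o n b n≤2b)) (≤-reflexive (m∸n+n≡m b≤n))

  -- For `k ≤ suc n` this is Σ(n,k): the middle rows, added alternately on the two sides, have these
  -- sizes up to reflection.
  rows : ℕ → ℕ → ℕ
  rows n k = ∑ (downFrom k) (λ i → n C ⌊ n ∸ i /2⌋)

  -- Raising `k` by one can raise the minimum, by one, only at truncations with more than `k` sizes.
  -- For these `j ≤ J`, and the weights up to `J` add up to the next row.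
  ∑-weight-lengths : ∀ n k → ∑ (halfRange n) (λ j → weight n j * (k ⊓ (suc (n ∸ j) ∸ j))) ≤ rows n k
  ∑-weight-lengths n zero    = ≤-reflexive (∑-zero (halfRange n) (λ {j} _ → *-zeroʳ (weight n j)))
  ∑-weight-lengths n (suc k) = begin
    ∑ (halfRange n) (λ j → weight n j * (suc k ⊓ len j))
      ≤⟨ ∑-mono (halfRange n) (λ {j} j∈ → *-monoʳ-≤ (weight n j) (step j (≤-trans (m≤m+n j j) (∈-halfRange n j∈)))) ⟩
    ∑ (halfRange n) (λ j → weight n j * (𝟙 (j ≤ᵇ J) + k ⊓ len j))
      ≡⟨ ∑-cong (halfRange n) (λ {j} _ → *-distribˡ-+ (weight n j) _ _) ⟩
    ∑ (halfRange n) (λ j → weight n j * 𝟙 (j ≤ᵇ J) + weight n j * (k ⊓ len j))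
      ≡⟨ ∑-+ (halfRange n) (λ j → weight n j * 𝟙 (j ≤ᵇ J)) (λ j → weight n j * (k ⊓ len j)) ⟩
    ∑ (halfRange n) (λ j → weight n j * 𝟙 (j ≤ᵇ J)) + ∑ (halfRange n) (λ j → weight n j * (k ⊓ len j))
      ≤⟨ +-mono-≤ (≤-reflexive (∑-weight n J (≤-trans (⌊n/2⌋+⌊n/2⌋≤n (n ∸ k)) (m∸n≤m n k)))) (∑-weight-lengths n k) ⟩
    rows n (suc k) ∎
    where
    open ≤-Reasoning
    J = ⌊ n ∸ k /2⌋
    len : ℕ → ℕ
    len j = suc (n ∸ j) ∸ j
    step : ∀ j → j ≤ n → suc k ⊓ len j ≤ 𝟙 (j ≤ᵇ J) + k ⊓ len j
    step j j≤n with j ≤ᵇ J in p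
    ... | true  = ⊓-mono-≤ (≤-refl {suc k}) (n≤1+n (len j))
    ... | false = ≤-trans (m⊓n≤n (suc k) (len j)) (⊓-glb short ≤-refl)
      where
      2j>n∸k : n ∸ k < j + j
      2j>n∸k = ≰⇒> (λ q → absurd (trans (sym (≤ᵇ-true (m+m≤n⇒m≤⌊n/2⌋ {j} q))) p))
        where
        absurd : true ≢ false
        absurd ()
      n<k+2j : suc n ≤ j + (j + k)
      n<k+2j = ≤-trans (s≤s (m≤n+m∸n n k)) (≤-trans (≤-reflexive (sym (+-suc k (n ∸ k))))
        (≤-trans (+-monoʳ-≤ k 2j>n∸k) (≤-reflexive (rearrange k j))))
        where
        rearrange : ∀ k j → k + (j + j) ≡ j + (j + k)
        rearrange = solve-∀
      short : len j ≤ k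
      short = m≤n+o⇒m∸n≤o (suc (n ∸ j)) j
        (≤-trans (≤-reflexive (sym (+-∸-assoc 1 j≤n))) (m≤n+o⇒m∸n≤o (suc n) j n<k+2j))

  -- The weight of a single chain

  bottom : ℕ → List ℕ → ℕ
  bottom a []       = a
  bottom a (b ∷ bs) = bottom b bs

  -- `p` is an end part, `suc e` the merged gaps, `d` the number of gaps. Merging `p` with `suc e`
  -- leaves exactly `d` factors of the larger factorial. With `p = 0` there is nothing to merge, and
  -- the bound can fail by a factor `suc e`.
  parts-bound : ∀ p d e m → m ≤ p + d + e → 0 < p ⊎ (d ≡ 0 × e ≡ 0) →
    p ! * suc e ! * fall m d ≤ (p + d + e) !
  parts-bound p .0 .0 m m≤ (inj₂ (refl , refl)) rewrite +-identityʳ p | +-identityʳ p =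
    ≤-reflexive (trans (*-identityʳ _) (*-identityʳ _))
  parts-bound (suc p) d e m m≤ (inj₁ _) = begin
    suc p ! * suc e ! * fall m d                            ≤⟨ *-mono-≤ (!*!≤! p e) (fall-mono d (≤-trans m≤ (≤-reflexive total))) ⟩
    suc (p + e) ! * fall (d + suc (p + e)) d                ≡⟨ *-comm (suc (p + e) !) _ ⟩
    fall (d + suc (p + e)) d * suc (p + e) !                ≡⟨ fall-! d (suc (p + e)) ⟩
    (d + suc (p + e)) !                                     ≡⟨ cong _! total ⟨
    (suc p + d + e) !                                       ∎
    where
    open ≤-Reasoning
    rearrange : ∀ p d e → suc p + d + e ≡ d + suc (p + e)
    rearrange = solve-∀
    total = rearrange p d e

  -- All gaps are positive and merge into one; `e` is the number of sizes that the chain skips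
  -- between its ends.
  refinements-bound : ∀ a bs → Linked _>_ (a ∷ bs) →
    ∃ λ e → a ≡ bottom a bs + length bs + e × refinements a bs ≤ suc e ! * bottom a bs ! × (length bs ≡ 0 → e ≡ 0)
  refinements-bound a [] _ = 0 , sym (trans (+-identityʳ _) (+-identityʳ a)) , ≤-reflexive (sym (+-identityʳ _)) , λ _ → refl
  refinements-bound a (b ∷ bs) (b<a ∷ linked) with refinements-bound b bs linked
  ... | e , b≡ , bound , _ = e + q , a≡ , bound′ , λ ()
    where
    open ≤-Reasoning
    l = bottom b bs
    d = length bs
    q = a ∸ suc b
    a∸b : a ∸ b ≡ suc q
    a∸b = +-∸-assoc 1 b<a
    rearrange : ∀ l d e q → suc (l + d + e + q) ≡ l + suc d + (e + q)
    rearrange = solve-∀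
    a≡ : a ≡ l + suc d + (e + q)
    a≡ = trans (sym (m+[n∸m]≡n b<a)) (trans (cong (λ z → suc (z + q)) b≡) (rearrange l d e q))
    bound′ : (a ∸ b) ! * refinements b bs ≤ suc (e + q) ! * l !
    bound′ = begin
      (a ∸ b) ! * refinements b bs     ≤⟨ *-mono-≤ (≤-reflexive (cong _! a∸b)) bound ⟩
      suc q ! * (suc e ! * l !)        ≡⟨ *-assoc (suc q !) _ _ ⟨
      suc q ! * suc e ! * l !          ≤⟨ *-monoˡ-≤ (l !) (!*!≤! q e) ⟩
      suc (q + e) ! * l !              ≡⟨ cong (λ z → suc z ! * l !) (+-comm q e) ⟩
      suc (e + q) ! * l !              ∎

  -- Of the two bounds on `W`, the one for the end farther from the middle is used: its binomial
  -- coefficient cancels the factorial of the outer part at that end. What remains has length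
  -- `n ∸ l` or `a`; twice that is at least `n + d`, because `l + d ≤ a`.
  chain-bound : ∀ n a bs W → a ≤ n → Linked _>_ (a ∷ bs) → W ≤ n C a → W ≤ n C bottom a bs →
    length bs ≡ 0 ⊎ a < n →
    W * refinements n (a ∷ bs) * fall ⌊ n + suc (length bs) /2⌋ (length bs) ≤ n !
  chain-bound n a bs W a≤n linked W≤a W≤l ends with refinements-bound a bs linked
  ... | e , a≡ , bound , e≡0 = by-cases (≤-total (l + a) n)
    where
    open ≤-Reasoning
    l = bottom a bs
    d = length bs
    p = n ∸ a
    m = ⌊ n + suc d /2⌋
    m≡ : m ≡ ⌈ n + d /2⌉
    m≡ = cong ⌊_/2⌋ (+-suc n d)
    l≤a : l ≤ a
    l≤a = ≤-trans (m≤m+n l d) (≤-trans (m≤m+n (l + d) e) (≤-reflexive (sym a≡)))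
    l+d≤a : l + d ≤ a
    l+d≤a = ≤-trans (m≤m+n (l + d) e) (≤-reflexive (sym a≡))
    by-cases : l + a ≤ n ⊎ n ≤ l + a → W * refinements n (a ∷ bs) * fall m d ≤ n !
    by-cases (inj₁ l+a≤n) = begin
      W * (p ! * refinements a bs) * fall m d     ≤⟨ *-monoˡ-≤ (fall m d) (*-mono-≤ W≤l (*-monoʳ-≤ (p !) bound)) ⟩
      (n C l) * (p ! * (suc e ! * l !)) * fall m d  ≡⟨ rearrange (n C l) (p !) (suc e !) (l !) (fall m d) ⟩
      (n C l) * (l ! * (p ! * suc e ! * fall m d))  ≤⟨ *-monoʳ-≤ (n C l) (*-monoʳ-≤ (l !) (parts-bound p d e m m≤ nondegenerate)) ⟩
      (n C l) * (l ! * (p + d + e) !)               ≡⟨ cong (λ z → (n C l) * (l ! * z !)) total ⟩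
      (n C l) * (l ! * (n ∸ l) !)                   ≡⟨ nCk*k!*[n∸k]!≡n! l≤n ⟩
      n !                                         ∎
      where
      l≤n = ≤-trans l≤a a≤n
      rearrange : ∀ c x y z f → c * (x * (y * z)) * f ≡ c * (z * (x * y * f))
      rearrange = solve-∀
      shuffle : ∀ p l d e → p + d + e + l ≡ l + d + e + p
      shuffle = solve-∀
      total : p + d + e ≡ n ∸ l
      total = trans (sym (m+n∸n≡m (p + d + e) l)) (cong (_∸ l)
        (trans (shuffle p l d e) (trans (cong (_+ p) (sym a≡)) (m+[n∸m]≡n a≤n))))
      double : ∀ l d → l + (l + d) ≡ d + (l + l)
      double = solve-∀
      d≤ : d ≤ n ∸ (l + l)
      d≤ = m+n≤o⇒m≤o∸n d (≤-trans (≤-reflexive (sym (double l d))) (≤-trans (+-monoʳ-≤ l l+d≤a) l+a≤n))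
      l≤n∸l : l ≤ n ∸ l
      l≤n∸l = m+n≤o⇒m≤o∸n l (≤-trans (+-monoʳ-≤ l l≤a) l+a≤n)
      split : n + (n ∸ (l + l)) ≡ (n ∸ l) + (n ∸ l)
      split = trans (cong (n +_) (sym (∸-+-assoc n l l)))
        (trans (cong (_+ (n ∸ l ∸ l)) (sym (m∸n+n≡m l≤n)))
        (trans (+-assoc (n ∸ l) l _) (cong ((n ∸ l) +_) (m+[n∸m]≡n l≤n∸l))))
      m≤ : m ≤ p + d + e
      m≤ = ≤-trans (≤-reflexive m≡) (≤-trans
        (m≤n+n⇒⌈m/2⌉≤n (≤-trans (+-monoʳ-≤ n d≤) (≤-reflexive split))) (≤-reflexive (sym total)))
      nondegenerate : 0 < p ⊎ (d ≡ 0 × e ≡ 0)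
      nondegenerate = case ends of λ where
        (inj₁ d≡0)        → inj₂ (d≡0 , e≡0 d≡0)
        (inj₂ a<n) → inj₁ (m<n⇒0<n∸m a<n)
    by-cases (inj₂ n≤l+a) = begin
      W * (p ! * refinements a bs) * fall m d     ≤⟨ *-monoˡ-≤ (fall m d) (*-mono-≤ W≤a (*-monoʳ-≤ (p !) bound)) ⟩
      (n C a) * (p ! * (suc e ! * l !)) * fall m d  ≡⟨ rearrange (n C a) (p !) (suc e !) (l !) (fall m d) ⟩
      (n C a) * ((l ! * suc e ! * fall m d) * p !)  ≤⟨ *-monoʳ-≤ (n C a) (*-monoˡ-≤ (p !) (parts-bound l d e m m≤ nondegenerate)) ⟩
      (n C a) * ((l + d + e) ! * p !)               ≡⟨ cong (λ z → (n C a) * (z ! * p !)) a≡ ⟨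
      (n C a) * (a ! * p !)                         ≡⟨ nCk*k!*[n∸k]!≡n! a≤n ⟩
      n !                                         ∎
      where
      rearrange : ∀ c x y z f → c * (x * (y * z)) * f ≡ c * ((z * y * f) * x)
      rearrange = solve-∀
      shuffle : ∀ l a d → l + a + d ≡ a + (l + d)
      shuffle = solve-∀
      m≤ : m ≤ l + d + e
      m≤ = ≤-trans (≤-reflexive m≡) (≤-trans (m≤n+n⇒⌈m/2⌉≤n
        (≤-trans (+-monoˡ-≤ d n≤l+a) (≤-trans (≤-reflexive (shuffle l a d)) (+-monoʳ-≤ a l+d≤a)))) (≤-reflexive a≡))
      -- Here the part at the lower end is merged. Since `l + a` is at least `n`, `a < n` makes `l`
      -- positive too, so one hypothesis on the top serves both cases.
      nondegenerate : 0 < l ⊎ (d ≡ 0 × e ≡ 0)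
      nondegenerate = case ends of λ where
        (inj₁ d≡0)        → inj₂ (d≡0 , e≡0 d≡0)
        (inj₂ a<n) → inj₁ (≤-trans (m<n⇒0<n∸m a<n) (m≤n+o⇒m∸n≤o n a (≤-trans n≤l+a (≤-reflexive (+-comm l a)))))

  allSizes≤1 : ∀ r bs → allSizes r bs ≤ 1
  allSizes≤1 r []       = ≤-refl
  allSizes≤1 r (b ∷ bs) = *-mono-≤ (𝟙≤1 (r b)) (allSizes≤1 r bs)

  allSizes≤top : ∀ r a bs → allSizes r (a ∷ bs) ≤ 𝟙 (r a)
  allSizes≤top r a bs = ≤-trans (*-monoʳ-≤ (𝟙 (r a)) (allSizes≤1 r bs)) (≤-reflexive (*-identityʳ _))

  allSizes≤bottom : ∀ r a bs → allSizes r (a ∷ bs) ≤ 𝟙 (r (bottom a bs))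
  allSizes≤bottom r a []       = ≤-reflexive (*-identityʳ _)
  allSizes≤bottom r a (b ∷ bs) = ≤-trans (*-mono-≤ (𝟙≤1 (r a)) (allSizes≤bottom r b bs)) (≤-reflexive (*-identityˡ _))

  -- Averaging over the truncated chains

  -- The total weight of the truncations that keep every size in `s`.
  symmetricWeight : ℕ → List ℕ → ℕ
  symmetricWeight n s = ∑ (halfRange n) (λ j → weight n j * allSizes (symmetric n j) s)

  ∑-symmetricChains : ∀ {n} (F : Family n) k →
    ∑ (halfRange n) (λ j → weight n j * ∑ (intersections (onSizes (symmetric n j) F)) (_C suc k)) ≡
    ∑ (profilesFrom F k (members F)) (λ s → symmetricWeight n s * refinements n s)
  ∑-symmetricChains {n} F k = begin
    ∑ (halfRange n) (λ j → weight n j * ∑ (intersections (onSizes (symmetric n j) F)) (_C suc k))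
      ≡⟨ ∑-cong (halfRange n) (λ {j} _ → trans
           (cong (weight n j *_) (trans (∑-intersections-C (onSizes (symmetric n j) F) k) (∑-allProfiles-onSizes F (symmetric n j) k (refinements n))))
           (sym (∑-*ˡ S (weight n j) (λ s → allSizes (symmetric n j) s * refinements n s)))) ⟩
    ∑ (halfRange n) (λ j → ∑ S (λ s → weight n j * (allSizes (symmetric n j) s * refinements n s)))
      ≡⟨ ∑-swap (halfRange n) S _ ⟩
    ∑ S (λ s → ∑ (halfRange n) (λ j → weight n j * (allSizes (symmetric n j) s * refinements n s)))
      ≡⟨ ∑-cong S (λ {s} _ → trans (∑-cong (halfRange n) (λ {j} _ → sym (*-assoc (weight n j) _ _)))
           (∑-*ʳ (halfRange n) (refinements n s) (λ j → weight n j * allSizes (symmetric n j) s))) ⟩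
    ∑ S (λ s → symmetricWeight n s * refinements n s) ∎
    where
    open ≡-Reasoning
    S = profilesFrom F k (members F)

  -- A set of size b collects the weight C(n,b) on each of its b!(n - b)! maximal chains, hence
  -- `n !` whatever its size.
  ∑-symmetricChains-1 : ∀ {n} (F : Family n) →
    ∑ (halfRange n) (λ j → weight n j * ∑ (intersections (onSizes (symmetric n j) F)) (_C 1)) ≡ n ! * ∣ F ∣ᶠ
  ∑-symmetricChains-1 {n} F = begin
    ∑ (halfRange n) (λ j → weight n j * ∑ (intersections (onSizes (symmetric n j) F)) (_C 1))
      ≡⟨ ∑-symmetricChains F 0 ⟩
    ∑ (profilesFrom F 0 (members F)) (λ s → symmetricWeight n s * refinements n s)
      ≡⟨ ∑-profilesFrom F 0 (members F) _ ⟩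
    ∑ (members F) (λ B → symmetricWeight n (∣ B ∣ ∷ []) * refinements n (∣ B ∣ ∷ []) + 0)
      ≡⟨ ∑-cong (members F) (λ {B} _ → trans (+-identityʳ _) (trans (cong (_* refinements n (∣ B ∣ ∷ []))
           (trans (∑-cong (halfRange n) (λ {j} _ → cong (weight n j *_) (*-identityʳ (𝟙 (symmetric n j ∣ B ∣)))))
             (∑-weight-symmetric n ∣ B ∣ (∣p∣≤n B))))
           (trans (cong ((n C ∣ B ∣) *_) (*-comm ((n ∸ ∣ B ∣) !) (∣ B ∣ !))) (nCk*k!*[n∸k]!≡n! (∣p∣≤n B))))) ⟩
    ∑ (members F) (λ _ → n !)
      ≡⟨ trans (∑-const (members F) (n !)) (*-comm ∣ F ∣ᶠ (n !)) ⟩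
    n ! * ∣ F ∣ᶠ ∎
    where open ≡-Reasoning

  ∑-intersections-bound : ∀ {n} (F : Family n) k lo hi → (∀ A → F A ≡ true → lo ≤ ∣ A ∣ × ∣ A ∣ ≤ hi) →
    ∑ (intersections F) (_C 1) ≤ ∑ (intersections F) (_C suc k) + n ! * (k ⊓ (suc hi ∸ lo))
  ∑-intersections-bound {n} F k lo hi bd = begin
    ∑ (intersections F) (_C 1)
      ≤⟨ ∑-mono (intersections F) (λ {t} t∈ → ≤-trans (≤-reflexive (nC1≡n t)) (pointwise t (intersections-bound F lo hi bd t∈))) ⟩
    -- The factor 1 turns the constant term into a multiple of the number of maximal chains.
    ∑ (intersections F) (λ t → t C suc k + 1 * c)
      ≡⟨ ∑-+ (intersections F) (_C suc k) (λ _ → 1 * c) ⟩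
    ∑ (intersections F) (_C suc k) + ∑ (intersections F) (λ _ → 1 * c)
      ≡⟨ cong (∑ (intersections F) (_C suc k) +_) (trans (∑-*ʳ (intersections F) c (λ _ → 1)) (cong (_* c) (∑-intersections-1 F))) ⟩
    ∑ (intersections F) (_C suc k) + n ! * c ∎
    where
    open ≤-Reasoning
    c = k ⊓ (suc hi ∸ lo)
    pointwise : ∀ t → t ≤ suc hi ∸ lo → t ≤ t C suc k + 1 * c
    pointwise t t≤ rewrite *-identityˡ c | +-distribˡ-⊓ (t C suc k) k (suc hi ∸ lo) =
      ⊓-glb (t≤tC[k+1]+k t k) (≤-trans t≤ (m≤n+m _ (t C suc k)))

  ∑-symmetricChains-bound : ∀ {n} (F : Family n) k → k ≡ 0 ⊎ (∀ A → F A ≡ true → ∣ A ∣ < n) →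
    ∑ (profilesFrom F k (members F)) (λ s → symmetricWeight n s * refinements n s) * fall ⌊ n + suc k /2⌋ k
      ≤ n ! * copies (suc k) F
  ∑-symmetricChains-bound {n} F k nd = begin
    ∑ S (λ s → symmetricWeight n s * refinements n s) * M  ≡⟨ ∑-*ʳ S M _ ⟨
    ∑ S (λ s → symmetricWeight n s * refinements n s * M)  ≤⟨ ∑-mono S pointwise ⟩
    ∑ S (λ _ → n !)                                        ≡⟨ ∑-cong S (λ _ → sym (*-identityʳ (n !))) ⟩
    ∑ S (λ _ → n ! * 1)                                    ≡⟨ ∑-*ˡ S (n !) (λ _ → 1) ⟩
    n ! * ∑ S (λ _ → 1)                                    ≡⟨ cong (n ! *_) (copies≡∑ F k) ⟨
    n ! * copies (suc k) F                                 ∎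
    where
    open ≤-Reasoning
    S = profilesFrom F k (members F)
    M = fall ⌊ n + suc k /2⌋ k
    bound : ∀ a bs → a ≤ n → Linked _>_ (a ∷ bs) → length bs ≡ k → length bs ≡ 0 ⊎ a < n →
      symmetricWeight n (a ∷ bs) * refinements n (a ∷ bs) * M ≤ n !
    bound a bs a≤n linked refl = chain-bound n a bs (symmetricWeight n (a ∷ bs)) a≤n linked
      (≤-trans (∑-mono (halfRange n) (λ {j} _ → *-monoʳ-≤ (weight n j) (allSizes≤top (symmetric n j) a bs)))
        (≤-reflexive (∑-weight-symmetric n a a≤n)))
      (≤-trans (∑-mono (halfRange n) (λ {j} _ → *-monoʳ-≤ (weight n j) (allSizes≤bottom (symmetric n j) a bs)))
        (≤-reflexive (∑-weight-symmetric n (bottom a bs) (≤-trans (bottom≤ a bs linked) a≤n))))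
      where
      bottom≤ : ∀ a bs → Linked _>_ (a ∷ bs) → bottom a bs ≤ a
      bottom≤ a []       _           = ≤-refl
      bottom≤ a (b ∷ bs) (b<a ∷ lnk) = ≤-trans (bottom≤ b bs lnk) (<⇒≤ b<a)
    pointwise : ∀ {s} → s ∈ S → symmetricWeight n s * refinements n s * M ≤ n !
    pointwise s∈ with allProfiles-shape F k s∈
    ... | A , bs , refl , FA , linked , len = bound ∣ A ∣ bs (∣p∣≤n A) linked len
      (case nd of λ where
        (inj₁ k≡0) → inj₁ (trans len k≡0)
        (inj₂ <n)  → inj₂ (<n A FA))

  -- The averaging inequality, multiplied by `n !` and then cancelled. The term with `rows` stands
  -- on the right because `F` may have fewer sets than that.
  copies-bound-without-⊤ : ∀ {n} (F : Family n) k → k ≡ 0 ⊎ (∀ A → F A ≡ true → ∣ A ∣ < n) →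
    ∣ F ∣ᶠ * fall ⌊ n + suc k /2⌋ k ≤ copies (suc k) F + rows n k * fall ⌊ n + suc k /2⌋ k
  copies-bound-without-⊤ {n} F k nd = *-cancelˡ-≤ (n !) {{n !≢0}} (begin
    n ! * (∣ F ∣ᶠ * M)
      ≡⟨ *-assoc (n !) _ M ⟨
    n ! * ∣ F ∣ᶠ * M
      ≡⟨ cong (_* M) (∑-symmetricChains-1 F) ⟨
    ∑ (halfRange n) (λ j → weight n j * ∑ (I j) (_C 1)) * M
      ≤⟨ *-monoˡ-≤ M (∑-mono (halfRange n) (λ {j} _ → *-monoʳ-≤ (weight n j) (∑-intersections-bound (onSizes (symmetric n j) F) k j (n ∸ j) (in-range j)))) ⟩
    ∑ (halfRange n) (λ j → weight n j * (∑ (I j) (_C suc k) + n ! * (k ⊓ (suc (n ∸ j) ∸ j)))) * M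
      ≡⟨ cong (_* M) (trans (∑-cong (halfRange n) (λ {j} _ → distribute (weight n j) _ (n !) _))
           (trans (∑-+ (halfRange n) (λ j → weight n j * ∑ (I j) (_C suc k)) (λ j → n ! * (weight n j * (k ⊓ (suc (n ∸ j) ∸ j)))))
           (cong (∑ (halfRange n) (λ j → weight n j * ∑ (I j) (_C suc k)) +_)
             (∑-*ˡ (halfRange n) (n !) (λ j → weight n j * (k ⊓ (suc (n ∸ j) ∸ j))))))) ⟩
    (∑ (halfRange n) (λ j → weight n j * ∑ (I j) (_C suc k)) + n ! * ∑ (halfRange n) (λ j → weight n j * (k ⊓ (suc (n ∸ j) ∸ j)))) * M
      ≤⟨ *-monoˡ-≤ M (+-mono-≤ (≤-reflexive (∑-symmetricChains F k)) (*-monoʳ-≤ (n !) (∑-weight-lengths n k))) ⟩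
    (∑ S (λ s → symmetricWeight n s * refinements n s) + n ! * rows n k) * M
      ≡⟨ *-distribʳ-+ M (∑ S (λ s → symmetricWeight n s * refinements n s)) _ ⟩
    ∑ S (λ s → symmetricWeight n s * refinements n s) * M + n ! * rows n k * M
      ≤⟨ +-mono-≤ (∑-symmetricChains-bound F k nd) (≤-reflexive (*-assoc (n !) (rows n k) M)) ⟩
    n ! * copies (suc k) F + n ! * (rows n k * M)
      ≡⟨ *-distribˡ-+ (n !) (copies (suc k) F) (rows n k * M) ⟨
    n ! * (copies (suc k) F + rows n k * M) ∎)
    where
    open ≤-Reasoning
    S = profilesFrom F k (members F)
    M = fall ⌊ n + suc k /2⌋ k
    I : ℕ → List ℕ
    I j = intersections (onSizes (symmetric n j) F)
    in-range : ∀ j A → onSizes (symmetric n j) F A ≡ true → j ≤ ∣ A ∣ × ∣ A ∣ ≤ n ∸ j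
    in-range j A p with ∧-true (j ≤ᵇ ∣ A ∣) _ (proj₂ (∧-true (F A) _ p))
    ... | q , r = ≤ᵇ-true⁻ q , ≤ᵇ-true⁻ r
    distribute : ∀ w x y z → w * (x + y * z) ≡ w * x + y * (w * z)
    distribute = solve-∀

  -- Families that contain the full set

  ssub⇒ssub-⊤ : ∀ {n} (B A : Subset n) → ssub B A ≡ true → ssub B ⊤ ≡ true
  ssub⇒ssub-⊤ []            []            ()
  ssub⇒ssub-⊤ (inside ∷ B)  (inside ∷ A)  p = ssub⇒ssub-⊤ B A p
  ssub⇒ssub-⊤ (outside ∷ B) (_ ∷ A)       p = sub-⊤ B

  ∑-⊤ : ∀ {n} (g : Subset n → ℕ) → ∑ₛ g ≡ ∑ₛ (λ B → 𝟙 (ssub B ⊤) * g B) + g ⊤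
  ∑-⊤ {n} g = trans (∑-cong (allSubsets n) (λ {B} _ → trans (sym (*-identityˡ (g B))) (cong (λ b → 𝟙 b * g B) (sym (sub-⊤ B)))))
    (∑-sub ⊤ g)

  ∑-members-⊤ : ∀ {n} (F : Family n) g → ∑ (members F) g ≡ ∑ (members (below F ⊤)) g + 𝟙 (F ⊤) * g ⊤
  ∑-members-⊤ F g = trans (∑-members F g) (trans (∑-⊤ (λ B → 𝟙 (F B) * g B))
    (cong (_+ 𝟙 (F ⊤) * g ⊤) (sym (∑-below F ⊤ g))))

  chainsBelow-⊤ : ∀ {n} (F : Family n) k A → chainsBelow F k A ≡ chainsBelow (below F ⊤) k A
  chainsBelow-⊤ F zero    A = refl
  chainsBelow-⊤ F (suc k) A = trans (cong (λ xs → ∑ xs (chainsBelow F k)) (members-cong _ _ absorb))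
    (∑-cong (members (below (below F ⊤) A)) (λ {B} _ → chainsBelow-⊤ F k B))
    where
    absorb : ∀ B → below F A B ≡ below (below F ⊤) A B
    absorb B with F B | ssub B A in p
    ... | false | _     = refl
    ... | true  | true  rewrite ssub⇒ssub-⊤ B A p = refl
    ... | true  | false with ssub B ⊤
    ... | true  = refl
    ... | false = refl

  copies-⊤ : ∀ {n} (F : Family n) k → F ⊤ ≡ true →
    copies (suc (suc k)) F ≡ copies (suc (suc k)) (below F ⊤) + copies (suc k) (below F ⊤)
  copies-⊤ F k F⊤ = begin
    copies (suc (suc k)) F
      ≡⟨ copies-suc (suc k) F ⟩
    ∑ (members F) (chainsBelow F (suc k))
      ≡⟨ ∑-members-⊤ F (chainsBelow F (suc k)) ⟩
    ∑ (members (below F ⊤)) (chainsBelow F (suc k)) + 𝟙 (F ⊤) * ∑ (members (below F ⊤)) (chainsBelow F k)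
      ≡⟨ cong₂ _+_ (replace (suc k)) (trans (cong (λ b → 𝟙 b * ∑ (members (below F ⊤)) (chainsBelow F k)) F⊤) (trans (+-identityʳ _) (replace k))) ⟩
    copies (suc (suc k)) (below F ⊤) + copies (suc k) (below F ⊤) ∎
    where
    open ≡-Reasoning
    replace : ∀ k → ∑ (members (below F ⊤)) (chainsBelow F k) ≡ copies (suc k) (below F ⊤)
    replace k = trans (∑-cong (members (below F ⊤)) (λ {B} _ → chainsBelow-⊤ F k B)) (sym (copies-suc k (below F ⊤)))

  ∣∣ᶠ-⊤ : ∀ {n} (F : Family n) → F ⊤ ≡ true → ∣ F ∣ᶠ ≡ suc ∣ below F ⊤ ∣ᶠ
  ∣∣ᶠ-⊤ F F⊤ = trans (length≡∑ (members F)) (trans (∑-members-⊤ F (λ _ → 1)) (trans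
    (cong₂ _+_ (sym (length≡∑ (members (below F ⊤)))) (cong (λ b → 𝟙 b * 1) F⊤)) (+-comm ∣ below F ⊤ ∣ᶠ 1)))

  below-⊤-size : ∀ {n} (F : Family n) A → below F ⊤ A ≡ true → ∣ A ∣ < n
  below-⊤-size {n} F A p = subst (∣ A ∣ <_) (∣⊤∣≡n n) (ssub-size A ⊤ (proj₂ (∧-true (F A) _ p)))

  ¬ssub⇒⊤ : ∀ {n} (A : Subset n) → ssub A ⊤ ≡ false → A ≡ ⊤
  ¬ssub⇒⊤ []            p = refl
  ¬ssub⇒⊤ (inside ∷ A)  p = cong (inside ∷_) (¬ssub⇒⊤ A p)
  ¬ssub⇒⊤ (outside ∷ A) p = case trans (sym (sub-⊤ A)) p of λ ()

  size-without-⊤ : ∀ {n} (F : Family n) → F ⊤ ≡ false → ∀ A → F A ≡ true → ∣ A ∣ < n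
  size-without-⊤ {n} F F⊤ A FA with ssub A ⊤ in p
  ... | true  = subst (∣ A ∣ <_) (∣⊤∣≡n n) (ssub-size A ⊤ p)
  ... | false = case trans (sym FA) (trans (cong F (¬ssub⇒⊤ A p)) F⊤) of λ ()

  -- The leading factor of the longer falling factorial is at most `n`, and a row other than the two
  -- extreme ones has at least `n` sets.
  fall-row : ∀ n k → suc k ≤ n →
    fall ⌊ n + suc (suc k) /2⌋ (suc k) ≤ (n C ⌊ n ∸ k /2⌋) * fall ⌊ n + suc k /2⌋ k
  fall-row n k k<n with m≤n⇒m<n∨m≡n k<n
  -- For `n = suc k` the row may be extreme, with a single set; but then the last factor of the
  -- falling factorial is 1.
  ... | inj₂ refl = ≤-trans (*-mono-≤ (fall-mono k (≤-reflexive top)) (≤-reflexive last))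
                      (≤-trans (≤-reflexive (*-comm _ 1)) (*-monoˡ-≤ _ (1≤nCk (suc k) _ (≤-trans (⌊n/2⌋≤n _) (m∸n≤m (suc k) k)))))
    where
    top : ⌊ suc k + suc (suc k) /2⌋ ≡ ⌊ suc k + suc k /2⌋
    top = trans (cong ⌊_/2⌋ (+-suc (suc k) (suc k))) (trans (sym (n≡⌈n+n/2⌉ (suc k))) (n≡⌊n+n/2⌋ (suc k)))
    last : ⌊ suc k + suc (suc k) /2⌋ ∸ k ≡ 1
    last = trans (cong (_∸ k) (trans top (sym (n≡⌊n+n/2⌋ (suc k))))) (m+n∸n≡m 1 k)
  ... | inj₁ k+1<n = begin
    fall ⌊ n + suc (suc k) /2⌋ (suc k)        ≡⟨ cong (λ z → fall ⌊ z /2⌋ (suc k)) (trans (+-suc n (suc k)) (cong suc (+-suc n k))) ⟩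
    fall (suc ⌊ n + k /2⌋) (suc k)            ≡⟨ fall-suc ⌊ n + k /2⌋ k ⟩
    suc ⌊ n + k /2⌋ * fall ⌊ n + k /2⌋ k      ≤⟨ *-mono-≤ (≤-trans small (n≤nCk n _ positive proper))
                                                  (fall-mono k (⌊n/2⌋-mono (+-monoʳ-≤ n (n≤1+n k)))) ⟩
    (n C ⌊ n ∸ k /2⌋) * fall ⌊ n + suc k /2⌋ k ∎
    where
    open ≤-Reasoning
    small : suc ⌊ n + k /2⌋ ≤ n
    small = ≤-trans (≤-reflexive (cong ⌈_/2⌉ (sym (+-suc n k)))) (m≤n+n⇒⌈m/2⌉≤n (+-monoʳ-≤ n k<n))
    2≤n∸k : 2 ≤ n ∸ k
    2≤n∸k = m+n≤o⇒m≤o∸n 2 k+1<n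
    positive : 0 < ⌊ n ∸ k /2⌋
    positive = m+m≤n⇒m≤⌊n/2⌋ 2≤n∸k
    proper : ⌊ n ∸ k /2⌋ < n
    proper = ≤-trans (half< (n ∸ k) (≤-trans (s≤s z≤n) 2≤n∸k)) (m∸n≤m n k)
      where
      half< : ∀ m → 0 < m → ⌊ m /2⌋ < m
      half< (suc m) _ = ⌊n/2⌋<n m

  -- Deleting the full set lowers the left side by `M`, so at least `M` chains must contain it. They
  -- are the chains of `suc k` sets in `F′` with the full set put on top, and the bound for `k`
  -- supplies them.
  copies-bound : ∀ {n} k (F : Family n) → k ≤ n →
    ∣ F ∣ᶠ * fall ⌊ n + suc k /2⌋ k ≤ copies (suc k) F + rows n k * fall ⌊ n + suc k /2⌋ k
  copies-bound zero    F _ = copies-bound-without-⊤ F 0 (inj₁ refl)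
  copies-bound {n} (suc k) F k<n with F ⊤ in F⊤
  ... | false = copies-bound-without-⊤ F (suc k) (inj₂ (size-without-⊤ F F⊤))
  ... | true with ≤-<-connex ∣ F ∣ᶠ (rows n (suc k))
  ... | inj₁ few = ≤-trans (*-monoˡ-≤ _ few) (m≤n+m _ (copies (suc (suc k)) F))
  ... | inj₂ many = begin
    ∣ F ∣ᶠ * M
      ≡⟨ cong (_* M) (∣∣ᶠ-⊤ F F⊤) ⟩
    M + ∣ F′ ∣ᶠ * M
      ≤⟨ +-mono-≤ (≤-trans (fall-row n k k<n) through-⊤) (copies-bound-without-⊤ F′ (suc k) (inj₂ (below-⊤-size F))) ⟩
    copies (suc k) F′ + (copies (suc (suc k)) F′ + rows n (suc k) * M)
      ≡⟨ +-assoc (copies (suc k) F′) _ _ ⟨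
    copies (suc k) F′ + copies (suc (suc k)) F′ + rows n (suc k) * M
      ≡⟨ cong (_+ rows n (suc k) * M) (trans (+-comm (copies (suc k) F′) _) (sym (copies-⊤ F k F⊤))) ⟩
    copies (suc (suc k)) F + rows n (suc k) * M ∎
    where
    open ≤-Reasoning
    F′ = below F ⊤
    L = n C ⌊ n ∸ k /2⌋
    M = fall ⌊ n + suc (suc k) /2⌋ (suc k)
    M′ = fall ⌊ n + suc k /2⌋ k
    through-⊤ : L * M′ ≤ copies (suc k) F′
    -- `F` has more than `rows n (suc k)` sets, so `F′` has at least that many: the row `L` in
    -- addition to `rows n k`.
    through-⊤ = +-cancelʳ-≤ (rows n k * M′) (L * M′) (copies (suc k) F′) (begin
      L * M′ + rows n k * M′                ≡⟨ *-distribʳ-+ M′ L (rows n k) ⟨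
      rows n (suc k) * M′                   ≤⟨ *-monoˡ-≤ M′ (≤-pred (≤-trans many (≤-reflexive (∣∣ᶠ-⊤ F F⊤)))) ⟩
      ∣ F′ ∣ᶠ * M′                          ≤⟨ copies-bound k F′ (<⇒≤ k<n) ⟩
      copies (suc k) F′ + rows n k * M′     ∎)

  chainsFrom : ∀ {n} → Family n → ℕ → Subset n → ℕ
  chainsFrom F j A = 𝟙 (F A) * chainsBelow F j A

  copies≡∑-chainsFrom : ∀ {n} (F : Family n) k → copies (suc k) F ≡ ∑ₛ (chainsFrom F k)
  copies≡∑-chainsFrom F k = trans (copies-suc k F) (∑-members F (chainsBelow F k))

  -- Families within the rows u, …, u + k

  module _ {n : ℕ} (F : Family n) (u : ℕ) (u≤ : ∀ A → F A ≡ true → u ≤ ∣ A ∣) where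

    -- Sizes drop by at least one per step and stay at least `u`, so `j` steps do not fit below `A`.
    chainsFrom-low : ∀ j A → ∣ A ∣ < u + j → chainsFrom F j A ≡ 0
    chainsFrom-low j A p with F A in FA
    ... | false = refl
    chainsFrom-low zero    A p | true = ⊥-elim (<⇒≱ p (subst (_≤ ∣ A ∣) (sym (+-identityʳ u)) (u≤ A FA)))
    chainsFrom-low (suc j) A p | true = trans (+-identityʳ _) (trans (∑-below F A (chainsBelow F j))
      (∑-zero (allSubsets n) (λ {B} _ → vanish B)))
      where
      vanish : ∀ B → 𝟙 (ssub B A) * chainsFrom F j B ≡ 0
      vanish B with ssub B A in q
      ... | false = refl
      ... | true  = trans (+-identityʳ _) (chainsFrom-low j B
        (≤-trans (ssub-size B A q) (≤-pred (subst (∣ A ∣ <_) (+-suc u j) p))))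

    -- There is no room to skip a size: the next set of the chain has size exactly `u + j`.
    chainsBelow-covers : ∀ j A → ∣ A ∣ ≡ u + suc j → chainsBelow F (suc j) A ≡ ∑ (covers A) (chainsFrom F j)
    chainsBelow-covers j A p = trans (∑-below F A (chainsBelow F j)) (∑-ssub-covers A (chainsFrom F j)
      (λ B q → chainsFrom-low j B (≤-pred (subst (suc ∣ B ∣ <_) (trans p (+-suc u j)) q))))

    module _ (k : ℕ) (≤u+k : ∀ A → F A ≡ true → ∣ A ∣ ≤ u + k) where

      chainsFrom-high : ∀ j A → u + k < ∣ A ∣ → chainsFrom F j A ≡ 0
      chainsFrom-high j A p with F A in FA
      ... | false = refl
      ... | true  = ⊥-elim (<⇒≱ p (≤u+k A FA))

      -- With `X` as the top row, all lower rows are complete, so every descending path of covers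
      -- from a member of `X` is a chain of the family.
      copies-top : ∀ (X : Family n) → (∀ A → u ≤ ∣ A ∣ → ∣ A ∣ < u + k → F A ≡ true) →
        (∀ A → ∣ A ∣ ≢ u + k → X A ≡ false) → (∀ A → ∣ A ∣ ≡ u + k → X A ≡ F A) →
        copies (suc k) F ≡ ∣ X ∣ᶠ * fall (u + k) k
      copies-top X full X-off X-on = begin
        copies (suc k) F                      ≡⟨ copies≡∑-chainsFrom F k ⟩
        ∑ₛ (chainsFrom F k)                   ≡⟨ ∑-cong (allSubsets n) (λ {A} _ → at A) ⟩
        ∑ₛ (λ A → 𝟙 (X A) * fall (u + k) k)   ≡⟨ ∑-*ʳ (allSubsets n) (fall (u + k) k) (𝟙 ∘ X) ⟩
        ∑ₛ (𝟙 ∘ X) * fall (u + k) k           ≡⟨ cong (_* fall (u + k) k) (∣∣ᶠ≡∑ X) ⟨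
        ∣ X ∣ᶠ * fall (u + k) k               ∎
        where
        open ≡-Reasoning
        -- This holds for every `A` of this size, in `F` or not, because only the complete rows
        -- below it matter.
        count : ∀ j A → j ≤ k → ∣ A ∣ ≡ u + j → chainsBelow F j A ≡ fall (u + j) j
        count zero    A _   p = refl
        count (suc j) A j<k p = begin
          chainsBelow F (suc j) A           ≡⟨ chainsBelow-covers j A p ⟩
          ∑ (covers A) (chainsFrom F j)     ≡⟨ ∑-cong (covers A) (λ {B} B∈ → cover B (suc-injective (trans (∈-covers-size A B∈) p′))) ⟩
          ∑ (covers A) (λ _ → fall (u + j) j) ≡⟨ ∑-const (covers A) _ ⟩
          length (covers A) * fall (u + j) j  ≡⟨ cong (_* fall (u + j) j) (trans (length-covers A) p′) ⟩
          suc (u + j) * fall (u + j) j      ≡⟨ fall-suc (u + j) j ⟨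
          fall (suc (u + j)) (suc j)        ≡⟨ cong (λ z → fall z (suc j)) (+-suc u j) ⟨
          fall (u + suc j) (suc j)          ∎
          where
          p′ : ∣ A ∣ ≡ suc (u + j)
          p′ = trans p (+-suc u j)
          cover : ∀ B → ∣ B ∣ ≡ u + j → chainsFrom F j B ≡ fall (u + j) j
          cover B q = trans (cong (λ b → 𝟙 b * chainsBelow F j B) (full B
            (subst (u ≤_) (sym q) (m≤m+n u j)) (subst (_< u + k) (sym q) (+-monoʳ-< u j<k))))
            (trans (+-identityʳ _) (count j B (<⇒≤ j<k) q))
        at : ∀ A → chainsFrom F k A ≡ 𝟙 (X A) * fall (u + k) k
        at A with <-cmp ∣ A ∣ (u + k)
        ... | tri< p q _ = trans (chainsFrom-low k A p) (sym (cong (λ b → 𝟙 b * fall (u + k) k) (X-off A q)))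
        ... | tri> _ q p = trans (chainsFrom-high k A p) (sym (cong (λ b → 𝟙 b * fall (u + k) k) (X-off A q)))
        ... | tri≈ _ p _ = cong₂ (λ b c → 𝟙 b * c) (sym (X-on A p)) (count k A ≤-refl p)

      -- With `X` as the bottom row, the number of chains below a single set depends on how `X`
      -- lies; only the total over a row is determined. Going up one row multiplies that total by
      -- the number of sets covering a given set.
      copies-bottom : ∀ (X : Family n) → (∀ A → u < ∣ A ∣ → ∣ A ∣ ≤ u + k → F A ≡ true) →
        (∀ A → ∣ A ∣ ≢ u → X A ≡ false) → (∀ A → ∣ A ∣ ≡ u → X A ≡ F A) →
        copies (suc k) F ≡ ∣ X ∣ᶠ * fall (n ∸ u) k
      copies-bottom X full X-off X-on = begin
        copies (suc k) F          ≡⟨ copies≡∑-chainsFrom F k ⟩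
        ∑ₛ (chainsFrom F k)       ≡⟨ ∑-cong (allSubsets n) (λ {A} _ → top A) ⟩
        ∑ₛ (layer k)              ≡⟨ ∑-layer k ≤-refl ⟩
        ∣ X ∣ᶠ * fall (n ∸ u) k   ∎
        where
        open ≡-Reasoning
        layer : ℕ → Subset n → ℕ
        layer j A = 𝟙 (∣ A ∣ ≡ᵇ u + j) * chainsFrom F j A
        layer-on : ∀ j A → ∣ A ∣ ≡ u + j → layer j A ≡ chainsFrom F j A
        layer-on j A p = trans (cong (λ b → 𝟙 b * chainsFrom F j A) (≡ᵇ-true p)) (+-identityʳ _)
        layer-off : ∀ j A → ∣ A ∣ ≢ u + j → layer j A ≡ 0
        layer-off j A p = cong (λ b → 𝟙 b * chainsFrom F j A) (≡ᵇ-false p)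
        top : ∀ A → chainsFrom F k A ≡ layer k A
        top A with <-cmp ∣ A ∣ (u + k)
        ... | tri< p q _ = trans (chainsFrom-low k A p) (sym (layer-off k A q))
        ... | tri> _ q p = trans (chainsFrom-high k A p) (sym (layer-off k A q))
        ... | tri≈ _ p _ = sym (layer-on k A p)
        layer-suc : ∀ j → suc j ≤ k → ∀ A → layer (suc j) A ≡ ∑ (covers A) (layer j)
        layer-suc j j<k A with ∣ A ∣ ≟ u + suc j
        ... | yes p = begin
          layer (suc j) A                          ≡⟨ layer-on (suc j) A p ⟩
          chainsFrom F (suc j) A                   ≡⟨ cong (λ b → 𝟙 b * chainsBelow F (suc j) A)
                                                        (full A (subst (u <_) (sym p) (m<m+n u (s≤s z≤n)))
                                                                (subst (_≤ u + k) (sym p) (+-monoʳ-≤ u j<k))) ⟩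
          1 * chainsBelow F (suc j) A              ≡⟨ trans (+-identityʳ _) (chainsBelow-covers j A p) ⟩
          ∑ (covers A) (chainsFrom F j)            ≡⟨ ∑-cong (covers A) (λ {B} B∈ → sym (layer-on j B
                                                        (suc-injective (trans (∈-covers-size A B∈) (trans p (+-suc u j)))))) ⟩
          ∑ (covers A) (layer j)                   ∎
        ... | no ¬p = trans (layer-off (suc j) A ¬p) (sym (∑-zero (covers A) (λ {B} B∈ → layer-off j B
          (λ q → ¬p (trans (sym (∈-covers-size A B∈)) (trans (cong suc q) (sym (+-suc u j))))))))
        -- On the support of `layer j` the number of upper covers is constant.
        level : ∀ j A → (n ∸ ∣ A ∣) * layer j A ≡ (n ∸ u ∸ j) * layer j A
        level j A with ∣ A ∣ ≟ u + j
        ... | yes p = cong (_* layer j A) (trans (cong (n ∸_) p) (sym (∸-+-assoc n u j)))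
        ... | no ¬p rewrite layer-off j A ¬p = trans (*-zeroʳ (n ∸ ∣ A ∣)) (sym (*-zeroʳ (n ∸ u ∸ j)))
        ∑-layer : ∀ j → j ≤ k → ∑ₛ (layer j) ≡ ∣ X ∣ᶠ * fall (n ∸ u) j
        ∑-layer zero    _   = trans (∑-cong (allSubsets n) (λ {A} _ → at A)) (trans (sym (∣∣ᶠ≡∑ X)) (sym (*-identityʳ _)))
          where
          at : ∀ A → layer 0 A ≡ 𝟙 (X A)
          at A with ∣ A ∣ ≟ u + 0
          ... | yes p = trans (layer-on 0 A p) (trans (*-identityʳ _) (cong 𝟙 (sym (X-on A (trans p (+-identityʳ u))))))
          ... | no ¬p = trans (layer-off 0 A ¬p) (cong 𝟙 (sym (X-off A (λ p → ¬p (trans p (sym (+-identityʳ u)))))))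
        ∑-layer (suc j) j<k = begin
          ∑ₛ (layer (suc j))                            ≡⟨ ∑-cong (allSubsets n) (λ {A} _ → layer-suc j j<k A) ⟩
          ∑ₛ (λ A → ∑ (covers A) (layer j))             ≡⟨ ∑-covers-swap (layer j) ⟩
          ∑ₛ (λ B → (n ∸ ∣ B ∣) * layer j B)            ≡⟨ ∑-cong (allSubsets n) (λ {A} _ → level j A) ⟩
          ∑ₛ (λ B → (n ∸ u ∸ j) * layer j B)            ≡⟨ ∑-*ˡ (allSubsets n) (n ∸ u ∸ j) (layer j) ⟩
          (n ∸ u ∸ j) * ∑ₛ (layer j)                    ≡⟨ cong ((n ∸ u ∸ j) *_) (∑-layer j (<⇒≤ j<k)) ⟩
          (n ∸ u ∸ j) * (∣ X ∣ᶠ * fall (n ∸ u) j)       ≡⟨ rearrange (n ∸ u ∸ j) ∣ X ∣ᶠ (fall (n ∸ u) j) ⟩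
          ∣ X ∣ᶠ * fall (n ∸ u) (suc j)                 ∎
          where
          rearrange : ∀ a b c → a * (b * c) ≡ b * (c * a)
          rearrange = solve-∀

  -- Windows of consecutive rows

  window : ℕ → ℕ → ℕ → Bool
  window lo k b = (lo ≤ᵇ b) ∧ (suc b ≤ᵇ lo + k)

  window-true : ∀ {lo k b} → lo ≤ b → b < lo + k → window lo k b ≡ true
  window-true p q rewrite ≤ᵇ-true p | ≤ᵇ-true q = refl

  window-true⁻ : ∀ {lo k b} → window lo k b ≡ true → lo ≤ b × b < lo + k
  window-true⁻ {lo} {k} {b} p with ∧-true (lo ≤ᵇ b) (suc b ≤ᵇ lo + k) p
  ... | q , r = ≤ᵇ-true⁻ q , ≤ᵇ-true⁻ r

  window-low : ∀ {lo k b} → b < lo → window lo k b ≡ false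
  window-low p rewrite ≤ᵇ-false p = refl

  window-high : ∀ {lo k b} → lo + k ≤ b → window lo k b ≡ false
  window-high {lo} {k} {b} p rewrite ≤ᵇ-false (s≤s p) with lo ≤ᵇ b
  ... | true  = refl
  ... | false = refl

  window-top : ∀ lo k b → 𝟙 (window lo (suc k) b) ≡ 𝟙 (window lo k b) + 𝟙 (b ≡ᵇ lo + k)
  window-top lo k b with <-cmp b (lo + k)
  ... | tri< p q _ rewrite ≡ᵇ-false q | ≤ᵇ-true p | +-suc lo k | ≤ᵇ-true (m≤n⇒m≤1+n p) = sym (+-identityʳ _)
  ... | tri≈ _ refl _ rewrite window-true {lo} {suc k} (m≤m+n lo k) (≤-reflexive (sym (+-suc lo k)))
          | window-high {lo} {k} (≤-refl {lo + k}) | ≡ᵇ-true (refl {x = lo + k}) = refl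
  ... | tri> _ q p rewrite window-high {lo} {suc k} (≤-trans (≤-reflexive (+-suc lo k)) p)
          | window-high {lo} {k} (<⇒≤ p) | ≡ᵇ-false q = refl

  window-bottom : ∀ lo k b → 𝟙 (window lo (suc k) b) ≡ 𝟙 (b ≡ᵇ lo) + 𝟙 (window (suc lo) k b)
  window-bottom lo k b with <-cmp b lo
  ... | tri< p q _ rewrite window-low {lo} {suc k} p | window-low {suc lo} {k} (m≤n⇒m≤1+n p) | ≡ᵇ-false q = refl
  ... | tri≈ _ refl _ rewrite window-true {lo} {suc k} ≤-refl (m<m+n lo {suc k} (s≤s z≤n))
          | window-low {suc lo} {k} (≤-refl {suc lo}) | ≡ᵇ-true (refl {x = lo}) = refl
  ... | tri> _ q p rewrite ≡ᵇ-false q | ≤ᵇ-true p | ≤ᵇ-true (<⇒≤ p) | +-suc lo k = refl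

  ∑-row : ∀ n i → ∑ₛ {n} (λ A → 𝟙 (∣ A ∣ ≡ᵇ i)) ≡ n C i
  ∑-row zero    zero    = refl
  ∑-row zero    (suc i) = sym (k>n⇒nCk≡0 {0} {suc i} (s≤s z≤n))
  ∑-row (suc n) zero    = trans (∑ₛ-suc {n} (λ A → 𝟙 (∣ A ∣ ≡ᵇ 0))) (trans
    (cong₂ _+_ (∑-zero (allSubsets n) (λ _ → refl)) (∑-row n 0)) (trans (nC0≡1 n) (sym (nC0≡1 (suc n)))))
  ∑-row (suc n) (suc i) = trans (∑ₛ-suc {n} (λ A → 𝟙 (∣ A ∣ ≡ᵇ suc i))) (trans
    (cong₂ _+_ (∑-row n i) (∑-row n (suc i))) (nCk+nC[k+1]≡[n+1]C[k+1] n i))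

  -- Both versions of the k middle rows start at a size lo of this form.
  Middle : ℕ → ℕ → ℕ → Set
  Middle n k lo = lo + lo + k ≡ n ⊎ lo + lo + k ≡ suc n ⊎ lo + lo + k ≡ suc (suc n)

  -- Peel off the outer row farther from the middle, the upper one in case of a tie. The remaining
  -- window is again middle, and by symmetry the removed row has the size of the next term of
  -- `rows`.
  ∑-window : ∀ n k lo → k ≤ suc n → Middle n k lo → ∑ₛ {n} (λ A → 𝟙 (window lo k ∣ A ∣)) ≡ rows n k
  ∑-window n zero    lo _   _ = ∑-zero (allSubsets n) (λ {A} _ → cong 𝟙 (empty A))
    where
    empty : ∀ A → window lo 0 ∣ A ∣ ≡ false
    empty A with ≤-<-connex lo ∣ A ∣
    ... | inj₁ p = window-high {lo} {0} (≤-trans (≤-reflexive (+-identityʳ lo)) p)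
    ... | inj₂ p = window-low {lo} {0} p
  ∑-window n (suc k) lo (s≤s k≤n) mid = by-cases mid
    where
    open ≡-Reasoning
    W : ℕ → ℕ → ℕ
    W lo k = ∑ₛ {n} (λ A → 𝟙 (window lo k ∣ A ∣))
    W-top : W lo (suc k) ≡ n C (lo + k) + W lo k
    W-top = trans (∑-cong (allSubsets n) (λ {A} _ → window-top lo k ∣ A ∣)) (trans (∑-+ (allSubsets n) _ _)
      (trans (+-comm (W lo k) _) (cong (_+ W lo k) (∑-row n (lo + k)))))
    W-bottom : W lo (suc k) ≡ n C lo + W (suc lo) k
    W-bottom = trans (∑-cong (allSubsets n) (λ {A} _ → window-bottom lo k ∣ A ∣)) (trans (∑-+ (allSubsets n) _ _)
      (cong (_+ W (suc lo) k) (∑-row n lo)))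
    half-odd : ∀ l → suc (l + l) + k ≡ n → ⌊ n ∸ k /2⌋ ≡ l
    half-odd l e = trans (cong ⌊_/2⌋ (trans (cong (_∸ k) (sym e)) (m+n∸n≡m (suc (l + l)) k))) (sym (n≡⌈n+n/2⌉ l))
    by-cases : Middle n (suc k) lo → W lo (suc k) ≡ rows n (suc k)
    by-cases (inj₁ e) = trans W-bottom (cong₂ _+_
      (cong (n C_) (sym (half-odd lo (trans (sym (+-suc (lo + lo) k)) e))))
      (∑-window n k (suc lo) (m≤n⇒m≤1+n k≤n) (inj₂ (inj₁ (trans (shift lo k) (cong suc e))))))
      where
      shift : ∀ l k → suc l + suc l + k ≡ suc (l + l + suc k)
      shift = solve-∀
    by-cases (inj₂ (inj₁ e)) = trans W-top (cong₂ _+_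
      (begin
        n C (lo + k)       ≡⟨ cong (n C_) (trans (cong (_∸ lo) (sym e″)) (m+n∸m≡n lo (lo + k))) ⟨
        n C (n ∸ lo)       ≡⟨ nCk≡nC[n∸k] (subst (lo ≤_) e″ (m≤m+n lo (lo + k))) ⟨
        n C lo             ≡⟨ cong (n C_) (trans (cong ⌊_/2⌋ (trans (cong (_∸ k) (sym e′)) (m+n∸n≡m (lo + lo) k))) (sym (n≡⌊n+n/2⌋ lo))) ⟨
        n C ⌊ n ∸ k /2⌋    ∎)
      (∑-window n k lo (m≤n⇒m≤1+n k≤n) (inj₁ e′)))
      where
      e′ : lo + lo + k ≡ n
      e′ = suc-injective (trans (sym (+-suc (lo + lo) k)) e)
      e″ : lo + (lo + k) ≡ n
      e″ = trans (sym (+-assoc lo lo k)) e′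
    by-cases (inj₂ (inj₂ e)) = trans W-top (cong₂ _+_ (row lo e′) (∑-window n k lo (m≤n⇒m≤1+n k≤n) (inj₂ (inj₁ e′))))
      where
      e′ : lo + lo + k ≡ suc n
      e′ = suc-injective (trans (sym (+-suc (lo + lo) k)) e)
      row : ∀ l → l + l + k ≡ suc n → n C (l + k) ≡ n C ⌊ n ∸ k /2⌋
      row zero    p = ⊥-elim (<⇒≢ (s≤s k≤n) p)
      row (suc l) p = begin
        n C (suc l + k)    ≡⟨ cong (n C_) (trans (cong (_∸ l) (sym q)) (m+n∸m≡n l (suc l + k))) ⟨
        n C (n ∸ l)        ≡⟨ nCk≡nC[n∸k] (subst (l ≤_) q (m≤m+n l (suc l + k))) ⟨
        n C l              ≡⟨ cong (n C_) (half-odd l (trans (regroup l k) q)) ⟨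
        n C ⌊ n ∸ k /2⌋    ∎
        where
        q : l + (suc l + k) ≡ n
        q = trans (sym (+-assoc l (suc l) k)) (suc-injective p)
        regroup : ∀ l k → suc (l + l) + k ≡ l + (suc l + k)
        regroup = solve-∀

  -- Halves of integers

  open import Data.Integer as ℤ using (ℤ; +_; -[1+_]; 0ℤ; 1ℤ; -1ℤ)
  import Data.Integer.Properties as ℤ

  halfℕ : Rounding → ℕ → ℕ
  halfℕ floor   p = ⌊ p /2⌋
  halfℕ ceiling p = ⌈ p /2⌉

  n/2≡⌊n/2⌋ : ∀ n → n / 2 ≡ ⌊ n /2⌋
  n/2≡⌊n/2⌋ zero          = refl
  n/2≡⌊n/2⌋ (suc zero)    = refl
  n/2≡⌊n/2⌋ (suc (suc n)) = trans (m/n≡1+[m∸n]/n {suc (suc n)} {2} (s≤s (s≤s z≤n))) (cong suc (n/2≡⌊n/2⌋ n))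

  -- Division of a negative integer branches on the remainder of its absolute value; this ties that
  -- branch to whether the half of `suc p` steps up.
  suc-%2-cases : ∀ p → (suc p % 2 ≡ 0 × ⌊ suc p /2⌋ ≡ suc ⌊ p /2⌋) ⊎ (suc p % 2 ≡ 1 × ⌊ suc p /2⌋ ≡ ⌊ p /2⌋)
  suc-%2-cases zero          = inj₂ (refl , refl)
  suc-%2-cases (suc zero)    = inj₁ (refl , refl)
  suc-%2-cases (suc (suc p)) with suc-%2-cases p
  ... | inj₁ (q , r) = inj₁ (q , cong suc r)
  ... | inj₂ (q , r) = inj₂ (q , cong suc r)

  -[1+p]/2 : ∀ p → -[1+ p ] ℤ./ℕ 2 ≡ -[1+ ⌊ p /2⌋ ]
  -[1+p]/2 p with suc p % 2 | suc-%2-cases p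
  ... | zero  | inj₁ (_ , r) = cong (λ z → ℤ.- (+ z)) (trans (n/2≡⌊n/2⌋ (suc p)) r)
  ... | suc _ | inj₂ (_ , r) = cong -[1+_] (trans (n/2≡⌊n/2⌋ (suc p)) r)

  half-+ : ∀ r p → half r (+ p) ≡ + halfℕ r p
  half-+ floor   p       = cong +_ (n/2≡⌊n/2⌋ p)
  half-+ ceiling zero    = refl
  half-+ ceiling (suc p) = cong ℤ.-_ (-[1+p]/2 p)

  half-nonpositive : ∀ r q → half r (ℤ.- + q) ℤ.≤ 0ℤ
  half-nonpositive floor   zero    = ℤ.≤-refl
  half-nonpositive floor   (suc q) rewrite -[1+p]/2 q = ℤ.-≤+
  half-nonpositive ceiling q rewrite ℤ.neg-involutive (+ q) = ℤ.neg-≤-pos {q / 2} {0}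

  ⌊/2⌋-+ : ∀ p k → ⌊ p + (k + k) /2⌋ ≡ ⌊ p /2⌋ + k
  ⌊/2⌋-+ p zero    = trans (cong ⌊_/2⌋ (+-identityʳ p)) (sym (+-identityʳ _))
  ⌊/2⌋-+ p (suc k) = trans (cong ⌊_/2⌋ (shift p k)) (trans (cong suc (⌊/2⌋-+ p k)) (sym (+-suc ⌊ p /2⌋ k)))
    where
    shift : ∀ p k → p + (suc k + suc k) ≡ suc (suc (p + (k + k)))
    shift = solve-∀

  halfℕ-+ : ∀ r p k → halfℕ r (p + (k + k)) ≡ halfℕ r p + k
  halfℕ-+ floor   = ⌊/2⌋-+
  halfℕ-+ ceiling = ⌊/2⌋-+ ∘ suc

  ⌈/2⌉-cases : ∀ p → ⌈ p /2⌉ ≡ ⌊ p /2⌋ ⊎ ⌈ p /2⌉ ≡ suc ⌊ p /2⌋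
  ⌈/2⌉-cases p with suc-%2-cases p
  ... | inj₁ (_ , r) = inj₂ r
  ... | inj₂ (_ , r) = inj₁ r

  -- The families 𝓑 as windows

  lowest : Rounding → ℕ → ℕ → ℕ
  lowest r n k = halfℕ r (suc n ∸ k)

  -- The two roundings of a half add up to `suc n ∸ k` and differ by at most one; doubling one of
  -- them is off by at most one.
  lowest-middle : ∀ r n k → k ≤ suc n → Middle n k (lowest r n k)
  lowest-middle r n k k≤ = by-cases r (⌈/2⌉-cases p)
    where
    p = suc n ∸ k
    f = ⌊ p /2⌋
    c = ⌈ p /2⌉
    f+c+k : f + c + k ≡ suc n
    f+c+k = trans (cong (_+ k) (⌊n/2⌋+⌈n/2⌉≡n p)) (m∸n+n≡m k≤)
    by-cases : ∀ r → c ≡ f ⊎ c ≡ suc f → Middle n k (halfℕ r p)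
    by-cases floor   (inj₁ e) = inj₂ (inj₁ (trans (cong (λ z → f + z + k) (sym e)) f+c+k))
    by-cases floor   (inj₂ e) = inj₁ (suc-injective (trans (cong (_+ k) (sym (+-suc f f)))
      (trans (cong (λ z → f + z + k) (sym e)) f+c+k)))
    by-cases ceiling (inj₁ e) = inj₂ (inj₁ (trans (cong (λ z → z + c + k) e) f+c+k))
    by-cases ceiling (inj₂ e) = inj₂ (inj₂ (trans (cong (λ z → z + c + k) e) (cong suc f+c+k)))

  +n-+k+1≡⊖ : ∀ n k → + n ℤ.- + k ℤ.+ 1ℤ ≡ suc n ℤ.⊖ k
  +n-+k+1≡⊖ n k = begin
    + n ℤ.+ ℤ.- + k ℤ.+ 1ℤ     ≡⟨ ℤ.+-assoc (+ n) (ℤ.- + k) 1ℤ ⟩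
    + n ℤ.+ (ℤ.- + k ℤ.+ 1ℤ)   ≡⟨ cong (λ z → + n ℤ.+ z) (ℤ.+-comm (ℤ.- + k) 1ℤ) ⟩
    + n ℤ.+ (1ℤ ℤ.- + k)       ≡⟨ ℤ.+-assoc (+ n) 1ℤ (ℤ.- + k) ⟨
    + (n + 1) ℤ.- + k          ≡⟨ cong (λ z → + z ℤ.- + k) (+-comm n 1) ⟩
    + suc n ℤ.- + k            ≡⟨ ℤ.m-n≡m⊖n (suc n) k ⟩
    suc n ℤ.⊖ k                ∎
    where open ≡-Reasoning

  +n-+k+1 : ∀ n k → k ≤ suc n → + n ℤ.- + k ℤ.+ 1ℤ ≡ + (suc n ∸ k)
  +n-+k+1 n k k≤ = trans (+n-+k+1≡⊖ n k) (ℤ.⊖-≥ k≤)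

  -- A nonempty ground set makes the upper numerator the natural number `n + k`. Raised by two, it
  -- exceeds the lower numerator by `k + k`, so the same rounding gives ends exactly `k` rows apart.
  𝓑-window : ∀ r n k → k ≤ suc (suc n) → ∀ A → 𝓑 r (suc n) k A ≡ window (lowest r (suc n) k) k ∣ A ∣
  𝓑-window r n k k≤ A
    rewrite +n-+k+1 (suc n) k k≤ | half-+ r (suc (suc n) ∸ k) | half-+ r (n + k) =
    cong ((lowest r (suc n) k ≤ᵇ ∣ A ∣) ∧_)
      (≤ᵇ-cong (λ q → subst (suc ∣ A ∣ ≤_) top (s≤s q)) (λ q → ≤-pred (subst (suc ∣ A ∣ ≤_) (sym top) q)))
    where
    suc-halfℕ : ∀ r p → suc (halfℕ r p) ≡ halfℕ r (suc (suc p))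
    suc-halfℕ floor   p = refl
    suc-halfℕ ceiling p = refl
    top : suc (halfℕ r (n + k)) ≡ lowest r (suc n) k + k
    top = trans (suc-halfℕ r (n + k)) (trans (cong (λ z → halfℕ r (z + k)) (sym (m∸n+n≡m k≤)))
      (trans (cong (halfℕ r) (+-assoc (suc (suc n) ∸ k) k k)) (halfℕ-+ r (suc (suc n) ∸ k) k)))

  ∣𝓑∣ : ∀ r n k → k ≤ suc (suc n) → ∣ 𝓑 r (suc n) k ∣ᶠ ≡ rows (suc n) k
  ∣𝓑∣ r n k k≤ = trans (∣∣ᶠ≡∑ (𝓑 r (suc n) k)) (trans
    (∑-cong (allSubsets (suc n)) (λ {A} _ → cong 𝟙 (𝓑-window r n k k≤ A)))
    (∑-window (suc n) k (lowest r (suc n) k) k≤ (lowest-middle r (suc n) k k≤)))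

  𝓑-full : ∀ r n k → suc (suc n) ≤ k → ∀ A → 𝓑 r (suc n) k A ≡ true
  𝓑-full r n k k≥ A = cong₂ _∧_ (dec-true (_ ℤ.≤? _) low) (dec-true (_ ℤ.≤? _) high)
    where
    q = k ∸ suc (suc n)
    low≡ : + suc n ℤ.- + k ℤ.+ 1ℤ ≡ ℤ.- + q
    low≡ = trans (+n-+k+1≡⊖ (suc n) k) (ℤ.⊖-≤ k≥)
    low : half r (+ suc n ℤ.- + k ℤ.+ 1ℤ) ℤ.≤ + ∣ A ∣
    low rewrite low≡ = ℤ.≤-trans (half-nonpositive r q) (ℤ.+≤+ z≤n)
    halfℕ-mono : ∀ r {p q} → p ≤ q → halfℕ r p ≤ halfℕ r q
    halfℕ-mono floor   = ⌊n/2⌋-mono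
    halfℕ-mono ceiling = ⌈n/2⌉-mono
    halfℕ-double : ∀ r p → p ≡ halfℕ r (p + p)
    halfℕ-double floor   = n≡⌊n+n/2⌋
    halfℕ-double ceiling = n≡⌈n+n/2⌉
    high : + ∣ A ∣ ℤ.≤ half r (+ suc n ℤ.+ + k ℤ.- 1ℤ)
    high rewrite half-+ r (n + k) = ℤ.+≤+ (≤-trans (∣p∣≤n A) (≤-trans (≤-reflexive (halfℕ-double r (suc n)))
      (halfℕ-mono r (≤-trans (≤-reflexive (sym (+-suc n (suc n)))) (+-monoʳ-≤ n k≥)))))

  -- The product and the binomial coefficient of the theorem

  ∏≡fall : ∀ m k → k ≤ m → ∏ k (λ i → + m ℤ.- + i ℤ.+ 1ℤ) ≡ + fall m k
  ∏≡fall m zero    _   = refl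
  ∏≡fall m (suc j) j<m = trans (cong₂ ℤ._*_ (∏≡fall m j (<⇒≤ j<m)) (+n-+k+1 m (suc j) (m≤n⇒m≤1+n j<m)))
    (sym (ℤ.pos-* (fall m j) (m ∸ j)))

  -1^[q+q] : ∀ q → -1ℤ ℤ.^ (q + q) ≡ 1ℤ
  -1^[q+q] zero    = refl
  -1^[q+q] (suc q) rewrite +-suc q q | -1^[q+q] q = refl

  even-or-odd : ∀ k → ∃ λ q → k ≡ q + q ⊎ k ≡ suc (q + q)
  even-or-odd zero    = 0 , inj₁ refl
  even-or-odd (suc k) with even-or-odd k
  ... | q , inj₁ refl = q , inj₂ refl
  ... | q , inj₂ refl = suc q , inj₁ (cong suc (sym (+-suc q q)))

  ⌊n∸2q/2⌋ : ∀ n q → ⌊ n ∸ (q + q) /2⌋ ≡ ⌊ n /2⌋ ∸ q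
  ⌊n∸2q/2⌋ n             zero    = refl
  ⌊n∸2q/2⌋ zero          (suc q) = refl
  ⌊n∸2q/2⌋ (suc zero)    (suc q) rewrite +-suc q q = refl
  ⌊n∸2q/2⌋ (suc (suc n)) (suc q) rewrite +-suc q q = ⌊n∸2q/2⌋ n q

  -- The binomial coefficient of the theorem is the size of the next middle row.
  binom-row : ∀ n k → let row = binom n (+ ⌊ n /2⌋ ℤ.+ -1ℤ ℤ.^ suc k ℤ.* + ⌊ suc k /2⌋) in
    (k ≤ n → row ≡ n C ⌊ n ∸ k /2⌋) × (n < k → row ≡ 0)
  binom-row n k with even-or-odd k
  -- An odd exponent: the index is `⌊ n /2⌋` minus `q`, and it is negative when there is no further
  -- row.
  ... | q , inj₁ refl
    rewrite -1^[q+q] q | sym (n≡⌈n+n/2⌉ q) | ℤ.-1*i≡-i (+ q) | ℤ.m-n≡m⊖n ⌊ n /2⌋ q = small , large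
    where
    small : q + q ≤ n → binom n (⌊ n /2⌋ ℤ.⊖ q) ≡ n C ⌊ n ∸ (q + q) /2⌋
    small p = trans (cong (binom n) (ℤ.⊖-≥ (m+m≤n⇒m≤⌊n/2⌋ {q} p))) (cong (n C_) (sym (⌊n∸2q/2⌋ n q)))
    large : n < q + q → binom n (⌊ n /2⌋ ℤ.⊖ q) ≡ 0
    large p with q ∸ ⌊ n /2⌋ | m<n⇒0<n∸m half< | ℤ.⊖-< half<
      where
      half< : ⌊ n /2⌋ < q
      half< = ≰⇒> (λ q≤ → <⇒≱ p (≤-trans (+-mono-≤ q≤ q≤) (⌊n/2⌋+⌊n/2⌋≤n n)))
    ... | suc d | _ | e = cong (binom n) e
  -- An even exponent: the index lies above the middle and is reflected to `⌈ n /2⌉ ∸ suc q`.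
  ... | q , inj₂ refl
    rewrite -1^[q+q] q | sym (n≡⌊n+n/2⌋ q) | +-identityʳ q = small , large
    where
    small : suc (q + q) ≤ n → n C (⌊ n /2⌋ + suc q) ≡ n C ⌊ n ∸ suc (q + q) /2⌋
    small p = begin
      n C (⌊ n /2⌋ + suc q)          ≡⟨ nCk≡nC[n∸k] bounded ⟩
      n C (n ∸ (⌊ n /2⌋ + suc q))    ≡⟨ cong (n C_) (sym (∸-+-assoc n ⌊ n /2⌋ (suc q))) ⟩
      n C (n ∸ ⌊ n /2⌋ ∸ suc q)      ≡⟨ cong (λ z → n C (z ∸ suc q)) upper ⟩
      n C (⌈ n /2⌉ ∸ suc q)          ≡⟨ cong (n C_) (⌊n∸2q/2⌋ (suc n) (suc q)) ⟨
      n C ⌊ suc n ∸ (suc q + suc q) /2⌋ ≡⟨ cong (λ z → n C ⌊ n ∸ z /2⌋) (+-suc q q) ⟩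
      n C ⌊ n ∸ suc (q + q) /2⌋      ∎
      where
      open ≡-Reasoning
      upper : n ∸ ⌊ n /2⌋ ≡ ⌈ n /2⌉
      upper = trans (cong (_∸ ⌊ n /2⌋) (sym (⌊n/2⌋+⌈n/2⌉≡n n))) (m+n∸m≡n ⌊ n /2⌋ ⌈ n /2⌉)
      bounded : ⌊ n /2⌋ + suc q ≤ n
      bounded = ≤-trans (+-monoʳ-≤ ⌊ n /2⌋ (m+m≤n⇒m≤⌊n/2⌋ {suc q} (s≤s (≤-trans (≤-reflexive (+-suc q q)) p))))
        (≤-reflexive (⌊n/2⌋+⌈n/2⌉≡n n))
    large : n < suc (q + q) → n C (⌊ n /2⌋ + suc q) ≡ 0
    large p = k>n⇒nCk≡0 (≤-trans (s≤s (≤-trans (≤-reflexive (sym (⌊n/2⌋+⌈n/2⌉≡n n)))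
      (+-monoʳ-≤ ⌊ n /2⌋ (m≤n+n⇒⌈m/2⌉≤n (≤-pred p))))) (≤-reflexive (sym (+-suc ⌊ n /2⌋ q))))

  -- Subfamilies and unions

  subfamily : ∀ {n} (Y : Family n) x → x ≤ ∑ₛ (𝟙 ∘ Y) → ∃ λ (X : Family n) → X ⊆ᶠ Y × ∑ₛ (𝟙 ∘ X) ≡ x
  subfamily {zero} Y zero x≤ = (λ _ → false) , (λ _ ()) , refl
  subfamily {zero} Y (suc x) x≤ = Y , (λ _ p → p) , ≤-antisym (≤-trans one (s≤s z≤n)) x≤
    where
    one : ∑ₛ {0} (𝟙 ∘ Y) ≤ 1
    one = ≤-trans (≤-reflexive (+-identityʳ _)) (𝟙≤1 (Y []))
  subfamily {suc n} Y x x≤ with ≤-total x (∑ₛ (𝟙 ∘ Y ∘ (inside ∷_)))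
  ... | inj₁ few with subfamily (Y ∘ (inside ∷_)) x few
  ... | X , X⊆ , ∣X∣ = X′ , X′⊆ , trans (∑ₛ-suc (𝟙 ∘ X′)) (trans (cong₂ _+_ ∣X∣ (∑-zero (allSubsets n) (λ _ → refl))) (+-identityʳ x))
    where
    X′ : Family (suc n)
    X′ (inside ∷ A)  = X A
    X′ (outside ∷ A) = false
    X′⊆ : X′ ⊆ᶠ Y
    X′⊆ (inside ∷ A)  = X⊆ A
    X′⊆ (outside ∷ A) ()
  subfamily {suc n} Y x x≤ | inj₂ many
    with subfamily (Y ∘ (outside ∷_)) (x ∸ ∑ₛ (𝟙 ∘ Y ∘ (inside ∷_)))
           (m≤n+o⇒m∸n≤o x _ (≤-trans x≤ (≤-reflexive (∑ₛ-suc (𝟙 ∘ Y)))))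
  ... | X , X⊆ , ∣X∣ = X′ , X′⊆ , trans (∑ₛ-suc (𝟙 ∘ X′)) (trans (cong (λ z → ∑ₛ (𝟙 ∘ Y ∘ (inside ∷_)) + z) ∣X∣) (m+[n∸m]≡n many))
    where
    X′ : Family (suc n)
    X′ (inside ∷ A)  = Y (inside ∷ A)
    X′ (outside ∷ A) = X A
    X′⊆ : X′ ⊆ᶠ Y
    X′⊆ (inside ∷ A)  p = p
    X′⊆ (outside ∷ A) = X⊆ A

  ⊆∖⇒ : ∀ {n} {X B′ B : Family n} → X ⊆ᶠ B′ ∖ᶠ B → ∀ A → X A ≡ true → B′ A ≡ true × B A ≡ false
  ⊆∖⇒ {X = X} {B′} {B} X⊆ A XA with B′ A | B A | X⊆ A (subst T (sym XA) _)
  ... | true | false | _ = refl , refl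

  ∣∪∣ : ∀ {n} (B X : Family n) → (∀ A → X A ≡ true → B A ≡ false) → ∣ B ∪ᶠ X ∣ᶠ ≡ ∣ X ∣ᶠ + ∣ B ∣ᶠ
  ∣∪∣ {n} B X disjoint = begin
    ∣ B ∪ᶠ X ∣ᶠ                     ≡⟨ ∣∣ᶠ≡∑ (B ∪ᶠ X) ⟩
    ∑ₛ (λ A → 𝟙 (B A ∨ X A))        ≡⟨ ∑-cong (allSubsets n) (λ {A} _ → pointwise A) ⟩
    ∑ₛ (λ A → 𝟙 (X A) + 𝟙 (B A))    ≡⟨ ∑-+ (allSubsets n) (𝟙 ∘ X) (𝟙 ∘ B) ⟩
    ∑ₛ (𝟙 ∘ X) + ∑ₛ (𝟙 ∘ B)         ≡⟨ cong₂ _+_ (∣∣ᶠ≡∑ X) (∣∣ᶠ≡∑ B) ⟨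
    ∣ X ∣ᶠ + ∣ B ∣ᶠ                 ∎
    where
    open ≡-Reasoning
    pointwise : ∀ A → 𝟙 (B A ∨ X A) ≡ 𝟙 (X A) + 𝟙 (B A)
    pointwise A with X A | B A | disjoint A
    ... | true  | true  | d = case d refl of λ ()
    ... | true  | false | _ = refl
    ... | false | true  | _ = refl
    ... | false | false | _ = refl

  -- The extremal families

  -- For every pair of roundings the smaller window lies at one end of the larger: they share the
  -- lower end, and the new row is on top, or the upper end, and it is at the bottom.
  lowest-suc : ∀ r s n k → k ≤ n → let p = n ∸ k in
    (lowest r n k ≡ ⌈ p /2⌉ × lowest s n (suc k) ≡ ⌈ p /2⌉) ⊎
    (lowest r n k ≡ suc ⌊ p /2⌋ × lowest s n (suc k) ≡ ⌊ p /2⌋)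
  lowest-suc r s n k k≤n rewrite +-∸-assoc 1 k≤n = by-cases r s (⌈/2⌉-cases p)
    where
    p = n ∸ k
    by-cases : ∀ r s → ⌈ p /2⌉ ≡ ⌊ p /2⌋ ⊎ ⌈ p /2⌉ ≡ suc ⌊ p /2⌋ →
      (halfℕ r (suc p) ≡ ⌈ p /2⌉ × halfℕ s p ≡ ⌈ p /2⌉) ⊎ (halfℕ r (suc p) ≡ suc ⌊ p /2⌋ × halfℕ s p ≡ ⌊ p /2⌋)
    by-cases floor   ceiling _        = inj₁ (refl , refl)
    by-cases ceiling floor   _        = inj₂ (refl , refl)
    by-cases floor   floor   (inj₁ e) = inj₁ (refl , sym e)
    by-cases floor   floor   (inj₂ e) = inj₂ (e , refl)
    by-cases ceiling ceiling (inj₁ e) = inj₂ (refl , e)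
    by-cases ceiling ceiling (inj₂ e) = inj₁ (sym e , refl)

  ∨-cases : ∀ a b → a ∨ b ≡ true → a ≡ true ⊎ b ≡ true
  ∨-cases true  b p = inj₁ refl
  ∨-cases false b p = inj₂ p

  ≢true⇒≡false : ∀ {b} → b ≢ true → b ≡ false
  ≢true⇒≡false {true}  p = ⊥-elim (p refl)
  ≢true⇒≡false {false} p = refl

  module _ {n : ℕ} (B B′ X : Family n) (k : ℕ) (X⊆ : ∀ A → X A ≡ true → B′ A ≡ true × B A ≡ false) where

    -- `X` lies in the larger window and avoids the smaller one, which confines it to the row in
    -- which they differ.
    copies-window-top : ∀ u → (∀ A → B A ≡ window u k ∣ A ∣) → (∀ A → B′ A ≡ window u (suc k) ∣ A ∣) →
      copies (suc k) (B ∪ᶠ X) ≡ ∣ X ∣ᶠ * fall (u + k) k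
    copies-window-top u B≡ B′≡ = copies-top (B ∪ᶠ X) u (λ A p → proj₁ (bounds A p)) k (λ A p → proj₂ (bounds A p)) X
      (λ A lo hi → cong (_∨ X A) (trans (B≡ A) (window-true lo hi)))
      (λ A off → ≢true⇒≡false (λ XA → off (level A XA)))
      (λ A on → sym (cong (_∨ X A) (trans (B≡ A) (window-high {u} {k} (≤-reflexive (sym on))))))
      where
      range : ∀ A → X A ≡ true → u ≤ ∣ A ∣ × ∣ A ∣ < u + suc k
      range A XA = window-true⁻ {u} {suc k} (trans (sym (B′≡ A)) (proj₁ (X⊆ A XA)))
      level : ∀ A → X A ≡ true → ∣ A ∣ ≡ u + k
      level A XA with range A XA
      ... | lo , hi with m≤n⇒m<n∨m≡n (≤-pred (subst (∣ A ∣ <_) (+-suc u k) hi))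
      ... | inj₂ p = p
      ... | inj₁ p = case trans (sym (proj₂ (X⊆ A XA))) (trans (B≡ A) (window-true lo p)) of λ ()
      bounds : ∀ A → B A ∨ X A ≡ true → u ≤ ∣ A ∣ × ∣ A ∣ ≤ u + k
      bounds A p with ∨-cases (B A) (X A) p
      ... | inj₂ XA = proj₁ (range A XA) , ≤-reflexive (level A XA)
      ... | inj₁ BA with window-true⁻ {u} {k} (trans (sym (B≡ A)) BA)
      ... | lo , hi = lo , <⇒≤ hi

    copies-window-bottom : ∀ u → (∀ A → B A ≡ window (suc u) k ∣ A ∣) → (∀ A → B′ A ≡ window u (suc k) ∣ A ∣) →
      copies (suc k) (B ∪ᶠ X) ≡ ∣ X ∣ᶠ * fall (n ∸ u) k
    copies-window-bottom u B≡ B′≡ = copies-bottom (B ∪ᶠ X) u (λ A p → proj₁ (bounds A p)) k (λ A p → proj₂ (bounds A p)) X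
      (λ A lo hi → cong (_∨ X A) (trans (B≡ A) (window-true lo (s≤s hi))))
      (λ A off → ≢true⇒≡false (λ XA → off (level A XA)))
      (λ A on → sym (cong (_∨ X A) (trans (B≡ A) (window-low {suc u} {k} (s≤s (≤-reflexive on))))))
      where
      range : ∀ A → X A ≡ true → u ≤ ∣ A ∣ × ∣ A ∣ < u + suc k
      range A XA = window-true⁻ {u} {suc k} (trans (sym (B′≡ A)) (proj₁ (X⊆ A XA)))
      level : ∀ A → X A ≡ true → ∣ A ∣ ≡ u
      level A XA with range A XA
      ... | lo , hi with m≤n⇒m<n∨m≡n lo
      ... | inj₂ p = sym p
      ... | inj₁ p = case trans (sym (proj₂ (X⊆ A XA)))
        (trans (B≡ A) (window-true p (subst (∣ A ∣ <_) (+-suc u k) hi))) of λ ()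
      bounds : ∀ A → B A ∨ X A ≡ true → u ≤ ∣ A ∣ × ∣ A ∣ ≤ u + k
      bounds A p with ∨-cases (B A) (X A) p
      ... | inj₂ XA = proj₁ (range A XA) , ≤-trans (≤-reflexive (level A XA)) (m≤m+n u k)
      ... | inj₁ BA with window-true⁻ {suc u} {k} (trans (sym (B≡ A)) BA)
      ... | lo , hi = <⇒≤ lo , ≤-pred hi

  -- Descending from a top row of size `⌈ p /2⌉ + k` and ascending from a bottom row of size
  -- `⌊ p /2⌋` start with the same number of choices, since these sizes are complementary.
  copies-extremal : ∀ r s n k (X : Family (suc n)) → k ≤ suc n → X ⊆ᶠ 𝓑 s (suc n) (suc k) ∖ᶠ 𝓑 r (suc n) k →
    copies (suc k) (𝓑 r (suc n) k ∪ᶠ X) ≡ ∣ X ∣ᶠ * fall ⌊ suc n + suc k /2⌋ k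
  copies-extremal r s n k X k≤ X⊆ = by-cases (lowest-suc r s (suc n) k k≤)
    where
    p = suc n ∸ k
    B = 𝓑 r (suc n) k
    B′ = 𝓑 s (suc n) (suc k)
    B≡ : ∀ {lo} → lowest r (suc n) k ≡ lo → ∀ A → B A ≡ window lo k ∣ A ∣
    B≡ refl = 𝓑-window r n k (m≤n⇒m≤1+n k≤)
    B′≡ : ∀ {lo} → lowest s (suc n) (suc k) ≡ lo → ∀ A → B′ A ≡ window lo (suc k) ∣ A ∣
    B′≡ refl = 𝓑-window s n (suc k) (s≤s k≤)
    m≡ : ⌊ suc n + suc k /2⌋ ≡ ⌈ p /2⌉ + k
    m≡ = trans (cong ⌊_/2⌋ (trans (cong (_+ suc k) (sym (m∸n+n≡m k≤))) (shift p k))) (⌊/2⌋-+ (suc p) k)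
      where
      shift : ∀ p k → p + k + suc k ≡ suc p + (k + k)
      shift = solve-∀
    n∸f : suc n ∸ ⌊ p /2⌋ ≡ ⌈ p /2⌉ + k
    n∸f = trans (cong (_∸ ⌊ p /2⌋) (trans (sym (m∸n+n≡m k≤)) (trans (cong (_+ k) (sym (⌊n/2⌋+⌈n/2⌉≡n p)))
      (+-assoc ⌊ p /2⌋ _ k)))) (m+n∸m≡n ⌊ p /2⌋ (⌈ p /2⌉ + k))
    by-cases : _ → copies (suc k) (B ∪ᶠ X) ≡ ∣ X ∣ᶠ * fall ⌊ suc n + suc k /2⌋ k
    by-cases (inj₁ (e , e′)) = trans (copies-window-top B B′ X k (⊆∖⇒ {B′ = B′} {B} X⊆) ⌈ p /2⌉ (B≡ e) (B′≡ e′))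
      (cong (λ m → ∣ X ∣ᶠ * fall m k) (sym m≡))
    by-cases (inj₂ (e , e′)) = trans (copies-window-bottom B B′ X k (⊆∖⇒ {B′ = B′} {B} X⊆) ⌊ p /2⌋ (B≡ e) (B′≡ e′))
      (cong (λ m → ∣ X ∣ᶠ * fall m k) (trans n∸f (sym m≡)))

  -- The claims of the theorem

  no-long-chains : ∀ {n} (F : Family n) k → n < k → copies (suc k) F ≡ 0
  no-long-chains {n} F k n<k = trans (copies≡∑-chainsFrom F k) (∑-zero (allSubsets n) (λ {A} _ →
    chainsFrom-low F 0 (λ _ _ → z≤n) k A (≤-trans (s≤s (∣p∣≤n A)) n<k)))

  chainFactor : ℕ → ℕ → ℤ
  chainFactor n k = ∏ k (λ i → + ⌊ n + suc k /2⌋ ℤ.- + i ℤ.+ 1ℤ)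

  nextRow : ℕ → ℕ → ℕ
  nextRow n k = binom n (+ ⌊ n /2⌋ ℤ.+ -1ℤ ℤ.^ suc k ℤ.* + ⌊ suc k /2⌋)

  chainFactor≡fall : ∀ n k → k ≤ n → chainFactor n k ≡ + fall ⌊ n + suc k /2⌋ k
  chainFactor≡fall n k k≤n = ∏≡fall ⌊ n + suc k /2⌋ k (m+m≤n⇒m≤⌊n/2⌋ (+-mono-≤ k≤n (n≤1+n k)))

  extremal : ∀ n k (r s : Rounding) (X : Family (suc n)) → X ⊆ᶠ 𝓑 s (suc n) (suc k) ∖ᶠ 𝓑 r (suc n) k →
    let F = 𝓑 r (suc n) k ∪ᶠ X
    in ∣ F ∣ᶠ ≡ ∣ X ∣ᶠ + Σ∣𝓑∣ (suc n) k × + copies (suc k) F ≡ + ∣ X ∣ᶠ ℤ.* chainFactor (suc n) k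
  extremal n k r s X X⊆ with ≤-<-connex k (suc n)
  ... | inj₁ k≤ =
      trans size (cong (λ z → ∣ X ∣ᶠ + z) (trans (∣𝓑∣ r n k k≤′) (sym (∣𝓑∣ floor n k k≤′))))
    , trans (cong +_ (copies-extremal r s n k X k≤ X⊆))
        (trans (ℤ.pos-* ∣ X ∣ᶠ _) (cong (λ z → + ∣ X ∣ᶠ ℤ.* z) (sym (chainFactor≡fall (suc n) k k≤))))
    where
    k≤′ = m≤n⇒m≤1+n k≤
    size = ∣∪∣ (𝓑 r (suc n) k) X (λ A XA → proj₂ (⊆∖⇒ {B′ = 𝓑 s (suc n) (suc k)} {𝓑 r (suc n) k} X⊆ A XA))
  -- Here the smaller family already contains every set, so `X` is empty and both counts of chains
  -- are 0.
  ... | inj₂ k> =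
      trans size (cong (λ z → ∣ X ∣ᶠ + z) (cong length (members-cong _ _ (λ A → trans (𝓑-full r n k k> A) (sym (𝓑-full floor n k k> A))))))
    , trans (cong +_ (no-long-chains (𝓑 r (suc n) k ∪ᶠ X) k k>)) (cong (λ z → + z ℤ.* chainFactor (suc n) k) (sym none))
    where
    X⊆′ = ⊆∖⇒ {B′ = 𝓑 s (suc n) (suc k)} {𝓑 r (suc n) k} X⊆
    size = ∣∪∣ (𝓑 r (suc n) k) X (λ A XA → proj₂ (X⊆′ A XA))
    none : ∣ X ∣ᶠ ≡ 0
    none = trans (∣∣ᶠ≡∑ X) (∑-zero (allSubsets (suc n)) (λ {A} _ → cong 𝟙 (≢true⇒≡false (λ XA →
      case trans (sym (𝓑-full r n k k> A)) (proj₂ (X⊆′ A XA)) of λ ()))))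

  ∣∖∣ : ∀ {n} (B′ B : Family n) → ∣ B′ ∣ᶠ ≤ ∑ₛ (𝟙 ∘ (B′ ∖ᶠ B)) + ∣ B ∣ᶠ
  ∣∖∣ {n} B′ B = begin
    ∣ B′ ∣ᶠ                                        ≡⟨ ∣∣ᶠ≡∑ B′ ⟩
    ∑ₛ (𝟙 ∘ B′)                                    ≤⟨ ∑-mono (allSubsets n) (λ {A} _ → pointwise (B′ A) (B A)) ⟩
    ∑ₛ (λ A → 𝟙 ((B′ ∖ᶠ B) A) + 𝟙 (B A))           ≡⟨ ∑-+ (allSubsets n) (𝟙 ∘ (B′ ∖ᶠ B)) (𝟙 ∘ B) ⟩
    ∑ₛ (𝟙 ∘ (B′ ∖ᶠ B)) + ∑ₛ (𝟙 ∘ B)                ≡⟨ cong (λ z → ∑ₛ (𝟙 ∘ (B′ ∖ᶠ B)) + z) (∣∣ᶠ≡∑ B) ⟨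
    ∑ₛ (𝟙 ∘ (B′ ∖ᶠ B)) + ∣ B ∣ᶠ                    ∎
    where
    open ≤-Reasoning
    pointwise : ∀ a b → 𝟙 a ≤ 𝟙 (a ∧ not b) + 𝟙 b
    pointwise false b     = z≤n
    pointwise true  true  = ≤-refl
    pointwise true  false = ≤-refl

  -- Ensures that the next middle row has room for `x` sets, so that the minimum is attained for
  -- every admissible `x`.
  nextRow-size : ∀ n k → nextRow (suc n) k ≤ ∑ₛ (𝟙 ∘ (𝓑 floor (suc n) (suc k) ∖ᶠ 𝓑 floor (suc n) k))
  nextRow-size n k with ≤-<-connex k (suc n)
  ... | inj₂ k> = ≤-trans (≤-reflexive (proj₂ (binom-row (suc n) k) k>)) z≤n
  ... | inj₁ k≤ = +-cancelʳ-≤ (rows (suc n) k) _ _ (begin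
    nextRow (suc n) k + rows (suc n) k      ≡⟨ cong (_+ rows (suc n) k) (proj₁ (binom-row (suc n) k) k≤) ⟩
    rows (suc n) (suc k)                    ≡⟨ ∣𝓑∣ floor n (suc k) (s≤s k≤) ⟨
    ∣ 𝓑 floor (suc n) (suc k) ∣ᶠ            ≤⟨ ∣∖∣ (𝓑 floor (suc n) (suc k)) (𝓑 floor (suc n) k) ⟩
    Y + ∣ 𝓑 floor (suc n) k ∣ᶠ              ≡⟨ cong (λ z → Y + z) (∣𝓑∣ floor n k (m≤n⇒m≤1+n k≤)) ⟩
    Y + rows (suc n) k                      ∎)
    where
    open ≤-Reasoning
    Y = ∑ₛ (𝟙 ∘ (𝓑 floor (suc n) (suc k) ∖ᶠ 𝓑 floor (suc n) k))

  minimum : ∀ n k x → x ≤ nextRow (suc n) k → (G : Family (suc n)) → ∣ G ∣ᶠ ≡ x + Σ∣𝓑∣ (suc n) k →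
    + x ℤ.* chainFactor (suc n) k ℤ.≤ + copies (suc k) G
  minimum n k x x≤ G ∣G∣ with ≤-<-connex k (suc n)
  -- Beyond the last row the binomial coefficient is 0, which forces `x = 0`.
  ... | inj₂ k> with n≤0⇒n≡0 (≤-trans x≤ (≤-reflexive (proj₂ (binom-row (suc n) k) k>)))
  ... | refl = ℤ.+≤+ z≤n
  minimum n k x x≤ G ∣G∣ | inj₁ k≤ = subst (ℤ._≤ + copies (suc k) G)
    (trans (ℤ.pos-* x M) (cong (λ z → + x ℤ.* z) (sym (chainFactor≡fall (suc n) k k≤))))
    (ℤ.+≤+ (+-cancelʳ-≤ (rows (suc n) k * M) (x * M) (copies (suc k) G) (begin
      x * M + rows (suc n) k * M                   ≡⟨ *-distribʳ-+ M x (rows (suc n) k) ⟨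
      (x + rows (suc n) k) * M                     ≡⟨ cong (λ z → (x + z) * M) (∣𝓑∣ floor n k (m≤n⇒m≤1+n k≤)) ⟨
      (x + Σ∣𝓑∣ (suc n) k) * M                     ≡⟨ cong (_* M) ∣G∣ ⟨
      ∣ G ∣ᶠ * M                                   ≤⟨ copies-bound k G k≤ ⟩
      copies (suc k) G + rows (suc n) k * M        ∎)))
    where
    open ≤-Reasoning
    M = fall ⌊ suc n + suc k /2⌋ k

  attained : ∀ n k x → x ≤ nextRow (suc n) k → ∃ λ (G : Family (suc n)) →
    ∣ G ∣ᶠ ≡ x + Σ∣𝓑∣ (suc n) k × + copies (suc k) G ≡ + x ℤ.* chainFactor (suc n) k
  attained n k x x≤ with subfamily (𝓑 floor (suc n) (suc k) ∖ᶠ 𝓑 floor (suc n) k) x (≤-trans x≤ (nextRow-size n k))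
  ... | X , X⊆ , ∣X∣ with extremal n k floor floor X X⊆
  ... | result rewrite trans (∣∣ᶠ≡∑ X) ∣X∣ = _ , result

open Supersaturation using (extremal; attained; minimum)
open import Data.Nat using (ℕ; _∸_; ⌊_/2⌋; NonZero; suc)
open import Data.Integer using (ℤ; +_; _+_; _-_; _*_; _^_; _≤_; 1ℤ; -1ℤ)
open import Data.Product using (_×_; ∃; _,_)
open import Relation.Binary.PropositionalEquality using (_≡_; refl)
import Data.Nat as ℕ

mainTheorem2 : (n k x : ℕ) → .{{_ : NonZero n}} → .{{_ : NonZero k}} →
    x ℕ.≤ binom n (+ ⌊ n /2⌋ + -1ℤ ^ k * + ⌊ k /2⌋) →
    let size = x ℕ.+ Σ∣𝓑∣ n (k ∸ 1)
        N = + x * ∏ (k ∸ 1) (λ i → + ⌊ n ℕ.+ k /2⌋ - + i + 1ℤ)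
    in ((r s : Rounding) (X : Family n) →
          X ⊆ᶠ 𝓑 s n k ∖ᶠ 𝓑 r n (k ∸ 1) →
          ∣ X ∣ᶠ ≡ x →
          let F = 𝓑 r n (k ∸ 1) ∪ᶠ X
          in ∣ F ∣ᶠ ≡ size × + copies k F ≡ N)
       × (∃ λ (G : Family n) → ∣ G ∣ᶠ ≡ size × + copies k G ≡ N)
       × ((G : Family n) → ∣ G ∣ᶠ ≡ size → N ≤ + copies k G)
mainTheorem2 (suc n) (suc k) x x≤ =
    (λ { r s X X⊆ refl → extremal n k r s X X⊆ })
  , attained n k x x≤
  , minimum n k x x≤
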